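{- For every unate DNF formula $f$ with width $w$ and size $m$ and every $\varepsilon>0$, there exist DNF formulae $f_\ell,f_u$, each with width $w$ and at most $(w\log(m/\varepsilon))^{O(w)}$ terms, which are $\varepsilon$-sandwiching approximators for $f$.
   Context: A term is an AND of literals; a DNF formula on $n$ variables is an OR of terms and computes a function $\{0,1\}^n\to\{0,1\}$. Its size is its number of terms and its width is the maximum number of literals in a term; a formula with width $w$ has at most $w$ literals in each term. A DNF formula is unate if it does not contain both a variable and its negation (anywhere in the formula). The constant implied by $O(w)$ is absolute. Functions $f_\ell,f_u:\{0,1\}^n\to\{0,1\}$ are $\varepsilon$-sandwiching approximators for $f$ if $f_\ell(x)\le f(x)\le f_u(x)$ for every $x\in\{0,1\}^n$, and $\Pr_x[f_\ell(x)\ne f(x)]\le\varepsilon$ and $\Pr_x[f_u(x)\ne f(x)]\le\varepsilon$ for $x$ uniform in $\{0,1\}^n$.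
   Formalization: The bound on the number of terms is read as max(1, (w·max(0, log₂(m/ε)))^{O(w)}), since the printed bound fails when w·log(m/ε) < 1 (e.g. f = x₁, ε = 3/4); ε ranges over positive rationals, which is equivalent to positive reals. -}

module Defs where

import Algebra.Definitions.RawSemiring
open import Data.Bool.Base using (Bool; true; false; not) renaming (_≤_ to _≤ᵇ_)
open import Data.Bool.Properties using (_≟_)
open import Data.Bool.ListAction using (all; any)
open import Data.Fin.Base using (Fin)
open import Data.Integer.Base using (+_; ∣_∣)
open import Data.List.Base using (List; []; _∷_; concat; map; foldr; length; filter; cartesianProductWith)
open import Data.List.Membership.Propositional using (_∈_)
open import Data.Nat.Base as ℕ using (ℕ; zero; suc)
open import Data.Nat.Properties using (m^n≢0)
open import Data.Product.Base using (_×_)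
open import Data.Rational.Base
  using (ℚ; _/_; _÷_; _*_; _≤_; _⊔_; 1ℚ; ↥_; ↧ₙ_; Positive; NonNegative; +-*-rawSemiring)
open import Data.Rational.Properties using (pos⇒nonZero)
open import Data.Vec.Base using (Vec; []; _∷_; lookup)
open import Relation.Nullary.Decidable using (¬?)
open import Relation.Nullary.Negation using (¬_)
open import Relation.Unary using (Pred; Decidable)

open Algebra.Definitions.RawSemiring +-*-rawSemiring public using (_^_)

fromℕ : ℕ → ℚ
fromℕ k = + k / 1

data Literal (n : ℕ) : Set where
  pos neg : Fin n → Literal n

Term : ℕ → Set
Term n = List (Literal n)

DNF : ℕ → Set
DNF n = List (Term n)

Cube : ℕ → Set
Cube n = Vec Bool n

evalLiteral : ∀ {n} → Literal n → Cube n → Bool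
evalLiteral (pos i) x = lookup x i
evalLiteral (neg i) x = not (lookup x i)

evalTerm : ∀ {n} → Term n → Cube n → Bool
evalTerm t x = all (λ l → evalLiteral l x) t

⟦_⟧ : ∀ {n} → DNF n → Cube n → Bool
⟦ f ⟧ x = any (λ t → evalTerm t x) f

size : ∀ {n} → DNF n → ℕ
size = length

width : ∀ {n} → DNF n → ℕ
width f = foldr ℕ._⊔_ 0 (map length f)

Unate : ∀ {n} → DNF n → Set
Unate {n} f = (i : Fin n) → ¬ (pos i ∈ concat f × neg i ∈ concat f)

-- Every point of {0,1}ⁿ, each listed exactly once.
points : ∀ n → List (Cube n)
points zero    = [] ∷ []
points (suc n) = cartesianProductWith _∷_ (false ∷ true ∷ []) (points n)

Pr : ∀ {n ℓ} {P : Pred (Cube n) ℓ} → Decidable P → ℚ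
Pr {n} P? = (+ length (filter P? (points n)) / (2 ℕ.^ n)) {{m^n≢0 2 n}}

record Sandwiching {n} (ε : ℚ) (fₗ fᵤ f : Cube n → Bool) : Set where
  field
    lower       : ∀ x → fₗ x ≤ᵇ f x
    upper       : ∀ x → f x ≤ᵇ fᵤ x
    lower-error : Pr (λ x → ¬? (fₗ x ≟ f x)) ≤ ε
    upper-error : Pr (λ x → ¬? (fᵤ x ≟ f x)) ≤ ε

-- For r = a/b ≥ 0 in lowest terms, log₂ y ≤ r means y ^ b ≤ 2 ^ a.  Only
-- meaningful for y ≥ 0 and r ≥ 0; log₂ 0 is read as -∞.
_IsUpperBoundOfLog₂_ : ℚ → ℚ → Set
r IsUpperBoundOfLog₂ y = y ^ (↧ₙ r) ≤ fromℕ 2 ^ ∣ ↥ r ∣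

-- The real inequality  N ≤ max(1, (w · max(0, log₂ y)) ^ k).  The real
-- max(0, log₂ y) is the infimum of the rationals r ≥ 0 with log₂ y ≤ r, and the
-- right-hand side is continuous and nondecreasing in it, so the inequality holds
-- exactly when it holds for all such r.  The maximum with 1 matters only when
-- w · log₂ y < 1; without it a single nonconstant term, with y = 1/ε close
-- to 1, would be required to be approximated from above by an empty formula.
_≤max[1,⟨_·log₂_⟩^_] : ℕ → ℕ → ℚ → ℕ → Set
N ≤max[1,⟨ w ·log₂ y ⟩^ k ] =
  ∀ r → .{{_ : NonNegative r}} → r IsUpperBoundOfLog₂ y →
  fromℕ N ≤ 1ℚ ⊔ (fromℕ w * r) ^ k

_/ε_ : ℕ → (ε : ℚ) .{{_ : Positive ε}} → ℚ
m /ε ε = (fromℕ m ÷ ε) {{pos⇒nonZero ε}}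

{-# OPTIONS --safe #-}
module Submission where

-- A unate formula is monotone after a change of signs, so a term is a set S of
-- coordinates.  Give S the weight K ^ (w ∸ ∣ S ∣) with K = 12 w L, 2 ^ L ≥ m / ε.
-- While there are more than 2 K ^ w terms, take a largest core Z such that the
-- terms containing Z have total weight above 2 K ^ (w ∸ ∣ Z ∣).  By maximality the
-- petals T ─ Z are spread: by Chebyshev, a point of bias 1 / 2L misses all of them
-- with probability at most 1/2.  A uniform point dominates a union of L independent
-- such points, so it misses all petals with probability at most 2 ^ - L ≤ ε / m.
-- Hence replacing all terms containing Z by Z (from above), or deleting one of them
-- (from below), costs at most ε / m, and there are at most m such steps.

open import Defs renaming (_^_ to _^ℚ_)
open import Data.Bool.Base using (Bool; true; false; not; _∧_; _∨_; _xor_; if_then_else_)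
  renaming (_≤_ to _≤ᵇ_)
open import Data.Bool.ListAction using (any)
import Data.Bool.Properties as Bool
open import Data.Fin.Base using (Fin; zero; suc)
import Data.Fin.Properties as Fin
open import Data.Fin.Subset using (Subset; ∣_∣; _∩_; _∪_; _─_; ⊤; ⊥; ⁅_⁆)
open import Data.Fin.Subset.Properties using (anySubset?; ∣p∣≤n; ∣⊥∣≡0; ∣⁅x⁆∣≡1)
open import Data.Integer.Base as ℤ using (-[1+_]; +[1+_]; +≤+)
import Data.Integer.Properties as ℤ
open import Data.List.Base using (List; []; _∷_; _++_; concat; filter; filterᵇ; length; map)
open import Data.List.Membership.Propositional using (_∈_)
open import Data.List.Membership.Propositional.Properties using (∈-++⁺ˡ; ∈-++⁺ʳ)
open import Data.List.Properties using (length-map; length-++; map-++; ++-identityʳ)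
open import Data.List.Relation.Binary.Permutation.Propositional as ↭ using (_↭_)
open import Data.List.Relation.Binary.Permutation.Propositional.Properties
  using (shift; map⁺; All-resp-↭; ↭-length)
open import Data.List.Relation.Unary.All using (All; []; _∷_)
import Data.List.Relation.Unary.All as All
import Data.List.Relation.Unary.All.Properties as All
open import Data.List.Relation.Unary.Any using (here; there; any?)
open import Data.Nat.Base hiding (_≤ᵇ_; _/_)
open import Data.Nat.Coprimality as Coprimality using (Coprime; 1-coprimeTo)
open import Data.Nat.ListAction using (sum)
open import Data.Nat.ListAction.Properties using (sum-↭; sum-++)
open import Data.Nat.Properties
open import Data.Nat.Tactic.RingSolver using (solve-∀)
open import Data.Product.Base using (∃; ∃-syntax; _×_; _,_; proj₁; proj₂)
open import Data.Rational.Base as ℚ using (ℚ; mkℚ; _/_; 1ℚ; Positive; NonNegative; *≤*)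
import Data.Rational.Properties as ℚ
import Data.Rational.Unnormalised.Base as ℚᵘ
import Data.Rational.Unnormalised.Properties as ℚᵘ
open import Data.Sum.Base using (inj₁; inj₂)
open import Data.Vec.Base using ([]; _∷_; head; lookup; tabulate; tail; zipWith)
open import Data.Vec.Properties using (lookup-zipWith; lookup∘tabulate)
open import Function.Base using (_∘_; flip)
open import Relation.Binary.Core using (Rel)
open import Relation.Binary.Definitions using (Reflexive; Transitive)
open import Relation.Binary.PropositionalEquality
  using (_≡_; refl; sym; trans; cong; cong₂; subst; subst₂; module ≡-Reasoning)
open import Relation.Nullary.Decidable using (Dec; yes; no; does; map′; ¬?; _×-dec_; dec-true; dec-false)
open import Relation.Nullary.Negation using (¬_; contradiction)
open import Relation.Unary using (Decidable)

private variable
  n : ℕ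
  A : Set

bernoulli : ∀ b k → suc b ^ k * (suc b ∸ k) ≤ b ^ k * suc b
bernoulli b zero = ≤-refl
bernoulli b (suc k) = begin
  suc b * suc b ^ k * (b ∸ k)    ≡⟨ rearrange (suc b) (suc b ^ k) (b ∸ k) ⟩
  suc b ^ k * (suc b * (b ∸ k))  ≤⟨ *-monoʳ-≤ (suc b ^ k) one-step ⟩
  suc b ^ k * (b * (suc b ∸ k))  ≡⟨ rearrange b (suc b ^ k) (suc b ∸ k) ⟨
  b * suc b ^ k * (suc b ∸ k)    ≡⟨ *-assoc b _ _ ⟩
  b * (suc b ^ k * (suc b ∸ k))  ≤⟨ *-monoʳ-≤ b (bernoulli b k) ⟩
  b * (b ^ k * suc b)            ≡⟨ *-assoc b _ _ ⟨
  b * b ^ k * suc b              ∎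
  where
  open ≤-Reasoning
  rearrange : ∀ x y z → x * y * z ≡ y * (x * z)
  rearrange = solve-∀
  one-step : suc b * (b ∸ k) ≤ b * (suc b ∸ k)
  one-step with k ≤? b
  ... | yes k≤b = begin
    b ∸ k + b * (b ∸ k)  ≤⟨ +-monoˡ-≤ _ (m∸n≤m b k) ⟩
    b + b * (b ∸ k)      ≡⟨ *-suc b (b ∸ k) ⟨
    b * suc (b ∸ k)      ≡⟨ cong (b *_) (+-∸-assoc 1 k≤b) ⟨
    b * (suc b ∸ k)      ∎
  ... | no k≰b = begin
    suc b * (b ∸ k)  ≡⟨ cong (suc b *_) (m≤n⇒m∸n≡0 (≰⇒≥ k≰b)) ⟩
    suc b * 0        ≡⟨ *-zeroʳ (suc b) ⟩
    0                ≤⟨ z≤n ⟩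
    b * (suc b ∸ k)  ∎

powerGap : ℕ → ℕ → ℕ
powerGap b zero    = 0
powerGap b (suc k) = b * powerGap b k + (b ^ k + powerGap b k)

powerGap-sum : ∀ b k → b ^ k + powerGap b k ≡ suc b ^ k
powerGap-sum b zero    = refl
powerGap-sum b (suc k) = begin
  b * b ^ k + (b * powerGap b k + (b ^ k + powerGap b k))  ≡⟨ factor b (b ^ k) (powerGap b k) ⟩
  suc b * (b ^ k + powerGap b k)                           ≡⟨ cong (suc b *_) (powerGap-sum b k) ⟩
  suc b * suc b ^ k                                        ∎
  where
  open ≡-Reasoning
  factor : ∀ b p c → b * p + (b * c + (p + c)) ≡ suc b * (p + c)
  factor = solve-∀

power-of-mean : ∀ b k {A B} → B ≤ A →
  b ^ k * A ^ k + powerGap b k * B ^ k ≤ (b * A + B) ^ k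
power-of-mean b zero    B≤A = ≤-refl
power-of-mean b (suc k) {A} {B} B≤A = begin
  b * p * (A * A ^ k) + (b * c + (p + c)) * (B * B ^ k)
    ≡⟨ expand b p c A (A ^ k) B (B ^ k) ⟩
  b * A * (p * A ^ k) + (b * B * (c * B ^ k) + (p * B * B ^ k + B * (c * B ^ k)))
    ≤⟨ +-monoʳ-≤ (b * A * (p * A ^ k)) (+-mono-≤
         (*-monoˡ-≤ (c * B ^ k) (*-monoʳ-≤ b B≤A))
         (+-monoˡ-≤ (B * (c * B ^ k)) (*-monoʳ-≤ (p * B) (^-monoˡ-≤ k B≤A)))) ⟩
  b * A * (p * A ^ k) + (b * A * (c * B ^ k) + (p * B * A ^ k + B * (c * B ^ k)))
    ≡⟨ collect (b * A) p c (A ^ k) B (B ^ k) ⟩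
  (b * A + B) * (p * A ^ k + c * B ^ k)
    ≤⟨ *-monoʳ-≤ (b * A + B) (power-of-mean b k B≤A) ⟩
  (b * A + B) * (b * A + B) ^ k ∎
  where
  open ≤-Reasoning
  p = b ^ k
  c = powerGap b k
  expand : ∀ b p c A Q B R →
    b * p * (A * Q) + (b * c + (p + c)) * (B * R) ≡
    b * A * (p * Q) + (b * B * (c * R) + (p * B * R + B * (c * R)))
  expand = solve-∀
  collect : ∀ D p c Q B R →
    D * (p * Q) + (D * (c * R) + (p * B * Q + B * (c * R))) ≡ (D + B) * (p * Q + c * R)
  collect = solve-∀

rearrangement : ∀ {a b c d} → a ≤ b → c ≤ d → b * c + a * d ≤ b * d + a * c
rearrangement {a} {c = c} a≤b c≤d with m≤n⇒∃[o]m+o≡n a≤b | m≤n⇒∃[o]m+o≡n c≤d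
... | u , refl | v , refl = begin
  (a + u) * c + a * (c + v)          ≤⟨ m≤m+n _ (u * v) ⟩
  (a + u) * c + a * (c + v) + u * v  ≡⟨ identity a u c v ⟩
  (a + u) * (c + v) + a * c          ∎
  where
  open ≤-Reasoning
  identity : ∀ a u c v → (a + u) * c + a * (c + v) + u * v ≡ (a + u) * (c + v) + a * c
  identity = solve-∀

mean-of-powers : ∀ b k {A B} → suc b ^ k ≤ 2 * b ^ k → B ≤ A →
  (A ^ k + B ^ k) * suc b ^ k ≤ 2 * (b * A + B) ^ k
mean-of-powers b k {A} {B} half B≤A = begin
  (A ^ k + B ^ k) * suc b ^ k
    ≡⟨ cong ((A ^ k + B ^ k) *_) (powerGap-sum b k) ⟨
  (A ^ k + B ^ k) * (p + c)
    ≡⟨ expand (A ^ k) (B ^ k) p c ⟩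
  p * A ^ k + c * B ^ k + (p * B ^ k + c * A ^ k)
    ≤⟨ +-monoʳ-≤ (p * A ^ k + c * B ^ k) (rearrangement c≤p (^-monoˡ-≤ k B≤A)) ⟩
  p * A ^ k + c * B ^ k + (p * A ^ k + c * B ^ k)
    ≤⟨ +-mono-≤ (power-of-mean b k B≤A) (power-of-mean b k B≤A) ⟩
  (b * A + B) ^ k + (b * A + B) ^ k
    ≡⟨ double ((b * A + B) ^ k) ⟩
  2 * (b * A + B) ^ k ∎
  where
  open ≤-Reasoning
  p = b ^ k
  c = powerGap b k
  double : ∀ x → x + x ≡ 2 * x
  double = solve-∀
  expand : ∀ Q R p c → (Q + R) * (p + c) ≡ p * Q + c * R + (p * R + c * Q)
  expand = solve-∀
  c≤p : c ≤ p
  c≤p = +-cancelˡ-≤ p c p (begin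
    p + c      ≡⟨ powerGap-sum b k ⟩
    suc b ^ k  ≤⟨ half ⟩
    2 * p      ≡⟨ double p ⟨
    p + p      ∎)

am-gm : ∀ a b → 2 * (a * b) ≤ a * a + b * b
am-gm a b with ≤-total a b
... | inj₁ a≤b = subst₂ _≤_ (left a b) (right a b) (rearrangement a≤b a≤b)
  where
  left : ∀ a b → b * a + a * b ≡ 2 * (a * b)
  left = solve-∀
  right : ∀ a b → b * b + a * a ≡ a * a + b * b
  right = solve-∀
... | inj₂ b≤a = subst (_≤ a * a + b * b) (left a b) (rearrangement b≤a b≤a)
  where
  left : ∀ a b → a * b + b * a ≡ 2 * (a * b)
  left = solve-∀

𝟙 : Bool → ℕ
𝟙 b = if b then 1 else 0

𝟙≤1 : ∀ b → 𝟙 b ≤ 1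
𝟙≤1 true  = ≤-refl
𝟙≤1 false = z≤n

infix 8 _⊑_
_⊑_ : Subset n → Cube n → Bool
[]          ⊑ []      = true
(true  ∷ S) ⊑ (b ∷ x) = b ∧ S ⊑ x
(false ∷ S) ⊑ (_ ∷ x) = S ⊑ x

⊑-refl : ∀ (x : Cube n) → x ⊑ x ≡ true
⊑-refl []          = refl
⊑-refl (true  ∷ x) = ⊑-refl x
⊑-refl (false ∷ x) = ⊑-refl x

⊑-trans : ∀ (S T x : Cube n) → S ⊑ T ≡ true → T ⊑ x ≡ true → S ⊑ x ≡ true
⊑-trans []          []          []          p q = refl
⊑-trans (true  ∷ S) (true  ∷ T) (true  ∷ x) p q = ⊑-trans S T x p q
⊑-trans (false ∷ S) (true  ∷ T) (true  ∷ x) p q = ⊑-trans S T x p q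
⊑-trans (false ∷ S) (false ∷ T) (_     ∷ x) p q = ⊑-trans S T x p q

-- The expectation of g, scaled by (b + 1) ^ n, when each coordinate is
-- independently true with probability 1 / (b + 1).
mass : ℕ → (Cube n → ℕ) → ℕ
mass {zero}  b g = g []
mass {suc n} b g = b * mass b (g ∘ (false ∷_)) + mass b (g ∘ (true ∷_))

mass-mono : ∀ b {g h : Cube n → ℕ} → (∀ x → g x ≤ h x) → mass b g ≤ mass b h
mass-mono {zero}  b g≤h = g≤h []
mass-mono {suc n} b g≤h =
  +-mono-≤ (*-monoʳ-≤ b (mass-mono b (g≤h ∘ (false ∷_)))) (mass-mono b (g≤h ∘ (true ∷_)))

mass-cong : ∀ b {g h : Cube n → ℕ} → (∀ x → g x ≡ h x) → mass b g ≡ mass b h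
mass-cong {zero}  b g≡h = g≡h []
mass-cong {suc n} b g≡h =
  cong₂ (λ u v → b * u + v) (mass-cong b (g≡h ∘ (false ∷_))) (mass-cong b (g≡h ∘ (true ∷_)))

mass-+ : ∀ b (g h : Cube n → ℕ) → mass b (λ x → g x + h x) ≡ mass b g + mass b h
mass-+ {zero}  b g h = refl
mass-+ {suc n} b g h = trans
  (cong₂ (λ u v → b * u + v)
    (mass-+ b (g ∘ (false ∷_)) (h ∘ (false ∷_))) (mass-+ b (g ∘ (true ∷_)) (h ∘ (true ∷_))))
  (interchange b (mass b (g ∘ (false ∷_))) (mass b (h ∘ (false ∷_)))
    (mass b (g ∘ (true ∷_))) (mass b (h ∘ (true ∷_))))
  where
  interchange : ∀ b x y u v → b * (x + y) + (u + v) ≡ b * x + u + (b * y + v)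
  interchange = solve-∀

mass-* : ∀ b c (g : Cube n → ℕ) → mass b (λ x → c * g x) ≡ c * mass b g
mass-* {zero}  b c g = refl
mass-* {suc n} b c g = trans
  (cong₂ (λ u v → b * u + v) (mass-* b c (g ∘ (false ∷_))) (mass-* b c (g ∘ (true ∷_))))
  (factor b c (mass b (g ∘ (false ∷_))) (mass b (g ∘ (true ∷_))))
  where
  factor : ∀ b c x y → b * (c * x) + c * y ≡ c * (b * x + y)
  factor = solve-∀

mass-const : ∀ n b c → mass {n} b (λ _ → c) ≡ suc b ^ n * c
mass-const zero    b c = sym (*-identityˡ c)
mass-const (suc n) b c = trans
  (cong (λ u → b * u + u) (mass-const n b c)) (factor b (suc b ^ n) c)
  where
  factor : ∀ b p c → b * (p * c) + p * c ≡ suc b * p * c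
  factor = solve-∀

Antitone : (Cube n → ℕ) → Set
Antitone g = ∀ x y → x ⊑ y ≡ true → g y ≤ g x

-- A uniform point dominates a union of k independent points of bias 1 / (b + 1),
-- since (1 - 1 / (b + 1)) ^ k ≥ 1/2; the induction on n replaces the coupling.
amplification : ∀ b k → suc b ^ k ≤ 2 * b ^ k → (g : Cube n → ℕ) →
  (∀ x → g x ≤ 1) → Antitone g →
  mass 1 g * (suc b ^ k) ^ n ≤ 2 ^ n * mass b g ^ k
amplification {zero} b k half g g≤1 anti = base (g []) (g≤1 [])
  where
  base : ∀ v → v ≤ 1 → v * 1 ≤ 1 * v ^ k
  base zero          _ = z≤n
  base (suc zero)    _ = ≤-reflexive (sym (trans (*-identityˡ (1 ^ k)) (^-zeroˡ k)))
  base (suc (suc _)) (s≤s ())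
amplification {suc n} b k half g g≤1 anti = begin
  (1 * mass 1 g₀ + mass 1 g₁) * (N * N ^ n)
    ≡⟨ expand (mass 1 g₀) (mass 1 g₁) N (N ^ n) ⟩
  (mass 1 g₀ * N ^ n + mass 1 g₁ * N ^ n) * N
    ≤⟨ *-monoˡ-≤ N (+-mono-≤
         (amplification b k half g₀ (g≤1 ∘ (false ∷_)) (λ x y → anti (false ∷ x) (false ∷ y)))
         (amplification b k half g₁ (g≤1 ∘ (true ∷_)) (λ x y → anti (true ∷ x) (true ∷ y)))) ⟩
  (2 ^ n * mass b g₀ ^ k + 2 ^ n * mass b g₁ ^ k) * N
    ≡⟨ collect (2 ^ n) (mass b g₀ ^ k) (mass b g₁ ^ k) N ⟩
  2 ^ n * ((mass b g₀ ^ k + mass b g₁ ^ k) * N)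
    ≤⟨ *-monoʳ-≤ (2 ^ n) (mean-of-powers b k half
         (mass-mono b (λ x → anti (false ∷ x) (true ∷ x) (⊑-refl x)))) ⟩
  2 ^ n * (2 * mass b g ^ k)
    ≡⟨ swap (2 ^ n) (mass b g ^ k) ⟩
  2 * 2 ^ n * mass b g ^ k ∎
  where
  open ≤-Reasoning
  g₀ = g ∘ (false ∷_)
  g₁ = g ∘ (true ∷_)
  N = suc b ^ k
  expand : ∀ x y p q → (1 * x + y) * (p * q) ≡ (x * q + y * q) * p
  expand = solve-∀
  collect : ∀ t x y p → (t * x + t * y) * p ≡ t * ((x + y) * p)
  collect = solve-∀
  swap : ∀ t x → t * (2 * x) ≡ 2 * t * x
  swap = solve-∀

^-distribʳ-* : ∀ k x y → (x * y) ^ k ≡ x ^ k * y ^ k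
^-distribʳ-* zero    x y = refl
^-distribʳ-* (suc k) x y = trans (cong (x * y *_) (^-distribʳ-* k x y)) (interchange x y (x ^ k) (y ^ k))
  where
  interchange : ∀ x y p q → x * y * (p * q) ≡ x * p * (y * q)
  interchange = solve-∀

amplify-half : ∀ b k → suc b ^ k ≤ 2 * b ^ k → (g : Cube n → ℕ) →
  (∀ x → g x ≤ 1) → Antitone g → 2 * mass b g ≤ suc b ^ n →
  mass 1 g * 2 ^ k ≤ 2 ^ n
amplify-half {n} b k half g g≤1 anti trial =
  *-cancelʳ-≤ _ _ ((suc b ^ k) ^ n) {{m^n≢0 (suc b ^ k) n {{m^n≢0 (suc b) k}}}} (begin
  mass 1 g * 2 ^ k * (suc b ^ k) ^ n    ≡⟨ swap (mass 1 g) (2 ^ k) _ ⟩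
  mass 1 g * (suc b ^ k) ^ n * 2 ^ k    ≤⟨ *-monoˡ-≤ (2 ^ k) (amplification b k half g g≤1 anti) ⟩
  2 ^ n * mass b g ^ k * 2 ^ k          ≡⟨ regroup (2 ^ n) (mass b g ^ k) (2 ^ k) ⟩
  2 ^ n * (2 ^ k * mass b g ^ k)        ≡⟨ cong (2 ^ n *_) (^-distribʳ-* k 2 (mass b g)) ⟨
  2 ^ n * (2 * mass b g) ^ k            ≤⟨ *-monoʳ-≤ (2 ^ n) (^-monoˡ-≤ k trial) ⟩
  2 ^ n * (suc b ^ n) ^ k               ≡⟨ cong (2 ^ n *_) exponents ⟩
  2 ^ n * (suc b ^ k) ^ n               ∎)
  where
  open ≤-Reasoning
  swap : ∀ x y z → x * y * z ≡ x * z * y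
  swap = solve-∀
  regroup : ∀ x y z → x * y * z ≡ x * (z * y)
  regroup = solve-∀
  exponents : (suc b ^ n) ^ k ≡ (suc b ^ k) ^ n
  exponents = trans (^-*-assoc (suc b) n k)
    (trans (cong (suc b ^_) (*-comm n k)) (sym (^-*-assoc (suc b) k n)))

∑ : List A → (A → ℕ) → ℕ
∑ G f = sum (map f G)

∑-mono : ∀ (G : List A) {f h : A → ℕ} → (∀ {a} → a ∈ G → f a ≤ h a) → ∑ G f ≤ ∑ G h
∑-mono []      f≤h = z≤n
∑-mono (a ∷ G) f≤h = +-mono-≤ (f≤h (here refl)) (∑-mono G (f≤h ∘ there))

∑-cong : ∀ (G : List A) {f h : A → ℕ} → (∀ a → f a ≡ h a) → ∑ G f ≡ ∑ G h
∑-cong []      f≡h = refl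
∑-cong (a ∷ G) f≡h = cong₂ _+_ (f≡h a) (∑-cong G f≡h)

∑-+ : ∀ (G : List A) (f h : A → ℕ) → ∑ G (λ a → f a + h a) ≡ ∑ G f + ∑ G h
∑-+ []      f h = refl
∑-+ (a ∷ G) f h = trans (cong (f a + h a +_) (∑-+ G f h))
  (interchange (f a) (h a) (∑ G f) (∑ G h))
  where
  interchange : ∀ x y u v → x + y + (u + v) ≡ x + u + (y + v)
  interchange = solve-∀

∑-* : ∀ (G : List A) c (f : A → ℕ) → ∑ G (λ a → c * f a) ≡ c * ∑ G f
∑-* []      c f = sym (*-zeroʳ c)
∑-* (a ∷ G) c f = trans (cong (c * f a +_) (∑-* G c f)) (sym (*-distribˡ-+ c (f a) (∑ G f)))

mass-∑ : ∀ b (G : List A) (f : A → Cube n → ℕ) →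
  mass b (λ x → ∑ G (λ a → f a x)) ≡ ∑ G (λ a → mass b (f a))
mass-∑ {n = n} b []      f = trans (mass-const n b 0) (*-zeroʳ (suc b ^ n))
mass-∑         b (a ∷ G) f = trans (mass-+ b (f a) _) (cong (mass b (f a) +_) (mass-∑ b G f))

-- The indicator of S ⊆ x, divided by its probability at bias 1 / N.
χ : ℕ → Subset n → Cube n → ℕ
χ N []          []       = 1
χ N (true ∷ S)  (b ∷ x)  = if b then N * χ N S x else 0
χ N (false ∷ S) (_ ∷ x)  = χ N S x

χ-vanishes : ∀ N (S : Subset n) x → S ⊑ x ≡ false → χ N S x ≡ 0
χ-vanishes N []          []          ()
χ-vanishes N (true ∷ S)  (true ∷ x)  S⋢x = trans (cong (N *_) (χ-vanishes N S x S⋢x)) (*-zeroʳ N)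
χ-vanishes N (true ∷ S)  (false ∷ x) S⋢x = refl
χ-vanishes N (false ∷ S) (_ ∷ x)     S⋢x = χ-vanishes N S x S⋢x

mass-zero : ∀ n b → mass {n} b (λ _ → 0) ≡ 0
mass-zero n b = trans (mass-const n b 0) (*-zeroʳ (suc b ^ n))

mass-χ : ∀ b (S : Subset n) → mass b (χ (suc b) S) ≡ suc b ^ n
mass-χ b [] = refl
mass-χ {suc n} b (true ∷ S) = begin
  b * mass {n} b (λ _ → 0) + mass b (λ x → suc b * χ (suc b) S x)
    ≡⟨ cong₂ (λ u v → b * u + v) (mass-zero n b) (mass-* b (suc b) (χ (suc b) S)) ⟩
  b * 0 + suc b * mass b (χ (suc b) S)
    ≡⟨ cong₂ (λ u v → u + suc b * v) (*-zeroʳ b) (mass-χ b S) ⟩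
  suc b ^ suc n ∎
  where open ≡-Reasoning
mass-χ {suc n} b (false ∷ S) = trans (cong (λ u → b * u + u) (mass-χ b S)) (+-comm (b * suc b ^ n) _)

mass-χχ : ∀ b (S T : Subset n) →
  mass b (λ x → χ (suc b) S x * χ (suc b) T x) ≡ suc b ^ n * suc b ^ ∣ S ∩ T ∣
mass-χχ b [] [] = refl
mass-χχ {suc n} b (true ∷ S) (true ∷ T) = begin
  b * mass {n} b (λ _ → 0) + mass b (λ x → N * χ N S x * (N * χ N T x))
    ≡⟨ cong₂ (λ u v → b * u + v) (mass-zero n b)
         (trans (mass-cong b (λ x → square N (χ N S x) (χ N T x)))
           (mass-* b (N * N) (λ x → χ N S x * χ N T x))) ⟩
  b * 0 + N * N * mass b (λ x → χ N S x * χ N T x)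
    ≡⟨ cong (λ v → b * 0 + N * N * v) (mass-χχ b S T) ⟩
  b * 0 + N * N * (N ^ n * N ^ ∣ S ∩ T ∣)
    ≡⟨ regroup b N (N ^ n) (N ^ ∣ S ∩ T ∣) ⟩
  N * N ^ n * (N * N ^ ∣ S ∩ T ∣) ∎
  where
  open ≡-Reasoning
  N = suc b
  square : ∀ N x y → N * x * (N * y) ≡ N * N * (x * y)
  square = solve-∀
  regroup : ∀ b N p q → b * 0 + N * N * (p * q) ≡ N * p * (N * q)
  regroup = solve-∀
mass-χχ {suc n} b (true ∷ S) (false ∷ T) = begin
  b * mass {n} b (λ _ → 0) + mass b (λ x → N * χ N S x * χ N T x)
    ≡⟨ cong₂ (λ u v → b * u + v) (mass-zero n b)
         (trans (mass-cong b (λ x → *-assoc N (χ N S x) (χ N T x)))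
           (mass-* b N (λ x → χ N S x * χ N T x))) ⟩
  b * 0 + N * mass b (λ x → χ N S x * χ N T x)
    ≡⟨ cong₂ (λ u v → u + N * v) (*-zeroʳ b) (mass-χχ b S T) ⟩
  N * (N ^ n * N ^ ∣ S ∩ T ∣)
    ≡⟨ *-assoc N (N ^ n) _ ⟨
  N * N ^ n * N ^ ∣ S ∩ T ∣ ∎
  where
  open ≡-Reasoning
  N = suc b
mass-χχ {suc n} b (false ∷ S) (true ∷ T) = begin
  b * mass b (λ x → χ N S x * 0) + mass b (λ x → χ N S x * (N * χ N T x))
    ≡⟨ cong₂ (λ u v → b * u + v)
         (trans (mass-cong b (λ x → *-zeroʳ (χ N S x))) (mass-zero n b))
         (trans (mass-cong b (λ x → pull N (χ N S x) (χ N T x)))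
           (mass-* b N (λ x → χ N S x * χ N T x))) ⟩
  b * 0 + N * mass b (λ x → χ N S x * χ N T x)
    ≡⟨ cong₂ (λ u v → u + N * v) (*-zeroʳ b) (mass-χχ b S T) ⟩
  N * (N ^ n * N ^ ∣ S ∩ T ∣)
    ≡⟨ *-assoc N (N ^ n) _ ⟨
  N * N ^ n * N ^ ∣ S ∩ T ∣ ∎
  where
  open ≡-Reasoning
  N = suc b
  pull : ∀ N x y → x * (N * y) ≡ N * (x * y)
  pull = solve-∀
mass-χχ {suc n} b (false ∷ S) (false ∷ T) = trans
  (cong (λ u → b * u + u) (mass-χχ b S T))
  (collect b (suc b ^ n) (suc b ^ ∣ S ∩ T ∣))
  where
  collect : ∀ b p q → b * (p * q) + p * q ≡ suc b * p * q
  collect = solve-∀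

module _ (N J : ℕ) where

  overlap-bound : ∀ (S : Subset n) (G : List A) (P : A → Subset n) (ω : A → ℕ) μ →
    (∀ Y → (N * J) ^ ∣ Y ∣ * ∑ G (λ a → ω a * 𝟙 (Y ⊑ P a)) ≤ μ) →
    J ^ ∣ S ∣ * ∑ G (λ a → ω a * N ^ ∣ S ∩ P a ∣) ≤ suc J ^ ∣ S ∣ * μ
  overlap-bound [] G P ω μ spread =
    subst (λ s → 1 * s ≤ 1 * μ) (∑-cong G (λ a → cong (ω a *_) (trivial (P a))))
      (≤-trans (spread []) (≤-reflexive (sym (*-identityˡ μ))))
    where
    trivial : (T : Subset 0) → 𝟙 ([] ⊑ T) ≡ N ^ ∣ [] ∩ T ∣
    trivial [] = refl
  overlap-bound (false ∷ S) G P ω μ spread =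
    subst (λ s → J ^ ∣ S ∣ * s ≤ suc J ^ ∣ S ∣ * μ)
      (∑-cong G (λ a → cong (ω a *_) (∩-false (P a))))
      (overlap-bound S G (tail ∘ P) ω μ (λ Y →
        subst (λ s → (N * J) ^ ∣ Y ∣ * s ≤ μ)
          (∑-cong G (λ a → cong (ω a *_) (⊑-false Y (P a)))) (spread (false ∷ Y))))
    where
    ∩-false : (T : Subset (suc _)) → N ^ ∣ S ∩ tail T ∣ ≡ N ^ ∣ (false ∷ S) ∩ T ∣
    ∩-false (_ ∷ T) = refl
    ⊑-false : ∀ Y (T : Subset (suc _)) → 𝟙 ((false ∷ Y) ⊑ T) ≡ 𝟙 (Y ⊑ tail T)
    ⊑-false Y (_ ∷ T) = refl
  overlap-bound (true ∷ S) G P ω μ spread = begin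
    J * j * ∑ G (λ a → ω a * N ^ ∣ (true ∷ S) ∩ P a ∣)
      ≤⟨ *-monoʳ-≤ (J * j) (∑-mono G (λ {a} _ → *-monoʳ-≤ (ω a) (∩-true (P a)))) ⟩
    J * j * ∑ G (λ a → ω a * (r a + t a * N * r a))
      ≡⟨ cong (J * j *_) (trans (∑-cong G (λ a → distribute (ω a) (r a) (t a) N)) (∑-+ G _ _)) ⟩
    J * j * (s₀ + s₁)
      ≡⟨ split J j s₀ s₁ ⟩
    J * (j * s₀) + j * (J * s₁)
      ≡⟨ cong (λ s → J * (j * s₀) + j * s)
           (trans (sym (∑-* G J _)) (∑-cong G (λ a → absorb J (ω a) (t a) N (r a)))) ⟩
    J * (j * s₀) + j * ∑ G (λ a → ω a * t a * (N * J) * r a)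
      ≤⟨ +-mono-≤
           (*-monoʳ-≤ J (overlap-bound S G (tail ∘ P) ω μ spread₀))
           (overlap-bound S G (tail ∘ P) (λ a → ω a * t a * (N * J)) μ spread₁) ⟩
    J * (suc J ^ ∣ S ∣ * μ) + suc J ^ ∣ S ∣ * μ
      ≡⟨ collect J (suc J ^ ∣ S ∣) μ ⟩
    suc J * suc J ^ ∣ S ∣ * μ ∎
    where
    open ≤-Reasoning
    j = J ^ ∣ S ∣
    t r : _ → ℕ
    t a = 𝟙 (head (P a))
    r a = N ^ ∣ S ∩ tail (P a) ∣
    s₀ = ∑ G (λ a → ω a * r a)
    s₁ = ∑ G (λ a → ω a * t a * N * r a)
    distribute : ∀ o p t N → o * (p + t * N * p) ≡ o * p + o * t * N * p
    distribute = solve-∀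
    split : ∀ J j s t → J * j * (s + t) ≡ J * (j * s) + j * (J * t)
    split = solve-∀
    absorb : ∀ J o t N p → J * (o * t * N * p) ≡ o * t * (N * J) * p
    absorb = solve-∀
    collect : ∀ J p m → J * (p * m) + p * m ≡ suc J * p * m
    collect = solve-∀
    ∩-true : (T : Subset (suc _)) →
      N ^ ∣ (true ∷ S) ∩ T ∣ ≤ N ^ ∣ S ∩ tail T ∣ + 𝟙 (head T) * N * N ^ ∣ S ∩ tail T ∣
    ∩-true (true ∷ T)  = ≤-trans (≤-reflexive (cong (_* N ^ ∣ S ∩ T ∣) (sym (*-identityˡ N)))) (m≤n+m _ _)
    ∩-true (false ∷ T) = m≤m+n _ _
    spread₀ : ∀ Y → (N * J) ^ ∣ Y ∣ * ∑ G (λ a → ω a * 𝟙 (Y ⊑ tail (P a))) ≤ μ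
    spread₀ Y = subst (λ s → (N * J) ^ ∣ Y ∣ * s ≤ μ)
      (∑-cong G (λ a → cong (ω a *_) (⊑-false (P a)))) (spread (false ∷ Y))
      where
      ⊑-false : (T : Subset (suc _)) → 𝟙 ((false ∷ Y) ⊑ T) ≡ 𝟙 (Y ⊑ tail T)
      ⊑-false (_ ∷ T) = refl
    spread₁ : ∀ Y → (N * J) ^ ∣ Y ∣ *
      ∑ G (λ a → ω a * 𝟙 (head (P a)) * (N * J) * 𝟙 (Y ⊑ tail (P a))) ≤ μ
    spread₁ Y = begin
      (N * J) ^ ∣ Y ∣ * ∑ G (λ a → ω a * 𝟙 (head (P a)) * (N * J) * 𝟙 (Y ⊑ tail (P a)))
        ≡⟨ cong ((N * J) ^ ∣ Y ∣ *_) (trans (∑-cong G (λ a → trans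
             (pull (ω a) (𝟙 (head (P a))) (N * J) (𝟙 (Y ⊑ tail (P a))))
             (cong (λ t → N * J * (ω a * t)) (⊑-true (P a))))) (∑-* G (N * J) _)) ⟩
      (N * J) ^ ∣ Y ∣ * (N * J * ∑ G (λ a → ω a * 𝟙 ((true ∷ Y) ⊑ P a)))
        ≡⟨ regroup ((N * J) ^ ∣ Y ∣) (N * J) _ ⟩
      (N * J) * (N * J) ^ ∣ Y ∣ * ∑ G (λ a → ω a * 𝟙 ((true ∷ Y) ⊑ P a))
        ≤⟨ spread (true ∷ Y) ⟩
      μ ∎
      where
      pull : ∀ o t k y → o * t * k * y ≡ k * (o * (t * y))
      pull = solve-∀
      regroup : ∀ p k s → p * (k * s) ≡ k * p * s
      regroup = solve-∀
      ⊑-true : (T : Subset (suc _)) → 𝟙 (head T) * 𝟙 (Y ⊑ tail T) ≡ 𝟙 ((true ∷ Y) ⊑ T)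
      ⊑-true (true ∷ T)  = *-identityˡ _
      ⊑-true (false ∷ T) = refl

small-power : ∀ {k J} → 3 * k ≤ J → 2 * suc J ^ k ≤ 3 * J ^ k
small-power {k} {J} 3k≤J = *-cancelʳ-≤ _ _ (suc J) (begin
  2 * suc J ^ k * suc J          ≡⟨ swap (suc J ^ k) (suc J) ⟩
  suc J ^ k * (2 * suc J)        ≤⟨ *-monoʳ-≤ (suc J ^ k) enough ⟩
  suc J ^ k * (3 * (suc J ∸ k))  ≡⟨ pull (suc J ^ k) (suc J ∸ k) ⟩
  3 * (suc J ^ k * (suc J ∸ k))  ≤⟨ *-monoʳ-≤ 3 (bernoulli J k) ⟩
  3 * (J ^ k * suc J)            ≡⟨ *-assoc 3 (J ^ k) (suc J) ⟨
  3 * J ^ k * suc J              ∎)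
  where
  open ≤-Reasoning
  swap : ∀ p s → 2 * p * s ≡ p * (2 * s)
  swap = solve-∀
  pull : ∀ p s → p * (3 * s) ≡ 3 * (p * s)
  pull = solve-∀
  enough : 2 * suc J ≤ 3 * (suc J ∸ k)
  enough = begin
    2 * suc J              ≡⟨ m+n∸m≡n (suc J) (2 * suc J) ⟨
    3 * suc J ∸ suc J      ≤⟨ ∸-monoʳ-≤ (3 * suc J) (m≤n⇒m≤1+n 3k≤J) ⟩
    3 * suc J ∸ 3 * k      ≡⟨ *-distribˡ-∸ 3 (suc J) k ⟨
    3 * (suc J ∸ k)        ∎

-- Chebyshev's inequality for X = ∑ ω (P a) χ (P a), of mean μ: spreadness bounds
-- the second moment of X by (3/2) μ², and X vanishes where no P a is satisfied.
spread⇒satisfied : ∀ b w .{{_ : NonZero w}} (G : List A) (P : A → Subset n) (ω : A → ℕ) →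
  (∀ {a} → a ∈ G → ∣ P a ∣ ≤ w) →
  .{{_ : NonZero (∑ G ω)}} →
  (∀ Y → (suc b * (3 * w)) ^ ∣ Y ∣ * ∑ G (λ a → ω a * 𝟙 (Y ⊑ P a)) ≤ ∑ G ω) →
  2 * mass b (λ x → 𝟙 (not (any (λ a → P a ⊑ x) G))) ≤ suc b ^ n
spread⇒satisfied {n = n} b w G P ω narrow spread =
  *-cancelʳ-≤ _ _ (μ * μ) {{m*n≢0 μ μ}} (+-cancelʳ-≤ (4 * (M * (μ * μ))) _ _ (begin
    2 * mass b g * (μ * μ) + 4 * (M * (μ * μ))
      ≡⟨ regroup (mass b g) μ M ⟩
    2 * (μ * μ * mass b g + 2 * μ * (M * μ))
      ≡⟨ cong (2 *_) (cong₂ _+_ (mass-* b (μ * μ) g)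
           (trans (mass-* b (2 * μ) X) (cong (2 * μ *_) mean))) ⟨
    2 * (mass b (λ x → μ * μ * g x) + mass b (λ x → 2 * μ * X x))
      ≡⟨ cong (2 *_) (mass-+ b (λ x → μ * μ * g x) (λ x → 2 * μ * X x)) ⟨
    2 * mass b (λ x → μ * μ * g x + 2 * μ * X x)
      ≤⟨ *-monoʳ-≤ 2 (mass-mono b chebyshev) ⟩
    2 * mass b (λ x → X x * X x + μ * μ)
      ≡⟨ cong (2 *_) (trans (mass-+ b (λ x → X x * X x) (λ _ → μ * μ))
           (cong₂ _+_ second-moment (mass-const n b (μ * μ)))) ⟩
    2 * (M * ∑ G (λ a → ω a * shared a) + M * (μ * μ))
      ≡⟨ factor M (∑ G (λ a → ω a * shared a)) (μ * μ) ⟩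
    M * (2 * ∑ G (λ a → ω a * shared a)) + 2 * (M * (μ * μ))
      ≤⟨ +-monoˡ-≤ _ (*-monoʳ-≤ M overlaps) ⟩
    M * (3 * (μ * μ)) + 2 * (M * (μ * μ))
      ≡⟨ collect M (μ * μ) ⟩
    M * (μ * μ) + 4 * (M * (μ * μ)) ∎))
  where
  open ≤-Reasoning
  N = suc b
  M = suc b ^ n
  μ = ∑ G ω
  g X : Cube n → ℕ
  g x = 𝟙 (not (any (λ a → P a ⊑ x) G))
  X x = ∑ G (λ a → ω a * χ N (P a) x)
  shared : _ → ℕ
  shared a = ∑ G (λ c → ω c * N ^ ∣ P a ∩ P c ∣)
  regroup : ∀ p m M → 2 * p * (m * m) + 4 * (M * (m * m)) ≡ 2 * (m * m * p + 2 * m * (M * m))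
  regroup = solve-∀
  factor : ∀ M s q → 2 * (M * s + M * q) ≡ M * (2 * s) + 2 * (M * q)
  factor = solve-∀
  collect : ∀ M q → M * (3 * q) + 2 * (M * q) ≡ M * q + 4 * (M * q)
  collect = solve-∀

  mean : mass b X ≡ M * μ
  mean = trans (mass-∑ b G (λ a x → ω a * χ N (P a) x)) (trans
    (∑-cong G (λ a → trans (mass-* b (ω a) (χ N (P a)))
      (trans (cong (ω a *_) (mass-χ b (P a))) (*-comm (ω a) M))))
    (∑-* G M ω))

  second-moment : mass b (λ x → X x * X x) ≡ M * ∑ G (λ a → ω a * shared a)
  second-moment = trans (mass-cong b square) 
    (trans (mass-∑ b G (λ a x → ω a * row-sum a x)) (trans (∑-cong G row) (∑-* G M _)))
    where
    row-sum : _ → Cube n → ℕ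
    row-sum a x = ∑ G (λ c → ω c * (χ N (P a) x * χ N (P c) x))
    square : ∀ x → X x * X x ≡ ∑ G (λ a → ω a * row-sum a x)
    square x = trans (sym (∑-* G (X x) _)) (∑-cong G (λ a → trans
      (pull (X x) (ω a) (χ N (P a) x))
      (cong (ω a *_) (trans (sym (∑-* G (χ N (P a) x) _))
        (∑-cong G (λ c → push (χ N (P a) x) (ω c) (χ N (P c) x)))))))
      where
      pull : ∀ s o t → s * (o * t) ≡ o * (t * s)
      pull = solve-∀
      push : ∀ t o s → t * (o * s) ≡ o * (t * s)
      push = solve-∀
    swap : ∀ x y z → x * (y * z) ≡ y * (x * z)
    swap = solve-∀
    row : ∀ a → mass b (λ x → ω a * row-sum a x) ≡ M * (ω a * shared a)
    row a = trans (mass-* b (ω a) (row-sum a)) (trans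
      (cong (ω a *_) (trans (mass-∑ b G (λ c x → ω c * (χ N (P a) x * χ N (P c) x))) (trans
        (∑-cong G (λ c → trans (mass-* b (ω c) (λ x → χ N (P a) x * χ N (P c) x)) (trans
          (cong (ω c *_) (mass-χχ b (P a) (P c))) (swap (ω c) M _))))
        (∑-* G M _))))
      (swap (ω a) M _))

  overlaps : 2 * ∑ G (λ a → ω a * shared a) ≤ 3 * (μ * μ)
  overlaps = begin
    2 * ∑ G (λ a → ω a * shared a)      ≡⟨ ∑-* G 2 _ ⟨
    ∑ G (λ a → 2 * (ω a * shared a))    ≤⟨ ∑-mono G row ⟩
    ∑ G (λ a → 3 * μ * ω a)              ≡⟨ ∑-* G (3 * μ) ω ⟩
    3 * μ * μ                            ≡⟨ *-assoc 3 μ μ ⟩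
    3 * (μ * μ)                          ∎
    where
    J = 3 * w
    swap : ∀ x y z → x * (y * z) ≡ y * (x * z)
    swap = solve-∀
    row : ∀ {a} → a ∈ G → 2 * (ω a * shared a) ≤ 3 * μ * ω a
    row {a} a∈G = begin
      2 * (ω a * shared a)  ≡⟨ swap 2 (ω a) (shared a) ⟩
      ω a * (2 * shared a)  ≤⟨ *-monoʳ-≤ (ω a) (*-cancelˡ-≤ (J ^ k) {{m^n≢0 J k {{m*n≢0 3 w}}}} bounded) ⟩
      ω a * (3 * μ)          ≡⟨ *-comm (ω a) (3 * μ) ⟩
      3 * μ * ω a            ∎
      where
      k = ∣ P a ∣
      bounded : J ^ k * (2 * shared a) ≤ J ^ k * (3 * μ)
      bounded = begin
        J ^ k * (2 * shared a)  ≡⟨ swap (J ^ k) 2 (shared a) ⟩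
        2 * (J ^ k * shared a)  ≤⟨ *-monoʳ-≤ 2 (overlap-bound N J (P a) G P ω μ spread) ⟩
        2 * (suc J ^ k * μ)      ≡⟨ *-assoc 2 (suc J ^ k) μ ⟨
        2 * suc J ^ k * μ        ≤⟨ *-monoˡ-≤ μ (small-power {k} (*-monoʳ-≤ 3 (narrow a∈G))) ⟩
        3 * J ^ k * μ            ≡⟨ *-assoc 3 (J ^ k) μ ⟩
        3 * (J ^ k * μ)          ≡⟨ swap 3 (J ^ k) μ ⟩
        J ^ k * (3 * μ)          ∎

  chebyshev : ∀ x → μ * μ * g x + 2 * μ * X x ≤ X x * X x + μ * μ
  chebyshev x with any (λ a → P a ⊑ x) G in satisfied
  ... | true  = begin
    μ * μ * 0 + 2 * μ * X x  ≡⟨ commute μ (X x) ⟩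
    2 * (X x * μ)            ≤⟨ am-gm (X x) μ ⟩
    X x * X x + μ * μ        ∎
    where
    commute : ∀ m s → m * m * 0 + 2 * m * s ≡ 2 * (s * m)
    commute = solve-∀
  ... | false = begin
    μ * μ * 1 + 2 * μ * X x  ≡⟨ cong₂ (λ s t → s + 2 * μ * t) (*-identityʳ (μ * μ)) (vanish G satisfied) ⟩
    μ * μ + 2 * μ * 0        ≡⟨ cong (μ * μ +_) (*-zeroʳ (2 * μ)) ⟩
    μ * μ + 0                ≡⟨ +-identityʳ (μ * μ) ⟩
    μ * μ                    ≤⟨ m≤n+m (μ * μ) (X x * X x) ⟩
    X x * X x + μ * μ        ∎
    where
    vanish : ∀ H → any (λ a → P a ⊑ x) H ≡ false → ∑ H (λ a → ω a * χ N (P a) x) ≡ 0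
    vanish []      _ = refl
    vanish (a ∷ H) unsatisfied with P a ⊑ x in eq
    ... | false = cong₂ _+_
      (trans (cong (ω a *_) (χ-vanishes N (P a) x eq)) (*-zeroʳ (ω a))) (vanish H unsatisfied)

⊑⇒∣∣≤ : ∀ (S T : Subset n) → S ⊑ T ≡ true → ∣ S ∣ ≤ ∣ T ∣
⊑⇒∣∣≤ []          []          _ = z≤n
⊑⇒∣∣≤ (true  ∷ S) (true  ∷ T) p = s≤s (⊑⇒∣∣≤ S T p)
⊑⇒∣∣≤ (false ∷ S) (true  ∷ T) p = m≤n⇒m≤1+n (⊑⇒∣∣≤ S T p)
⊑⇒∣∣≤ (false ∷ S) (false ∷ T) p = ⊑⇒∣∣≤ S T p

∣─∣≤ : ∀ (S Z : Subset n) → ∣ S ─ Z ∣ ≤ ∣ S ∣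
∣─∣≤ []          []          = z≤n
∣─∣≤ (true  ∷ S) (true  ∷ Z) = m≤n⇒m≤1+n (∣─∣≤ S Z)
∣─∣≤ (true  ∷ S) (false ∷ Z) = s≤s (∣─∣≤ S Z)
∣─∣≤ (false ∷ S) (true  ∷ Z) = ∣─∣≤ S Z
∣─∣≤ (false ∷ S) (false ∷ Z) = ∣─∣≤ S Z

⊥-⊑ : ∀ (x : Cube n) → ⊥ ⊑ x ≡ true
⊥-⊑ []      = refl
⊥-⊑ (_ ∷ x) = ⊥-⊑ x

─-⊑ : ∀ (T Z x : Subset n) → Z ⊑ x ≡ true → (T ─ Z) ⊑ x ≡ true → T ⊑ x ≡ true
─-⊑ []          []          []          p q = refl
─-⊑ (true  ∷ T) (true  ∷ Z) (true ∷ x)  p q = ─-⊑ T Z x p q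
─-⊑ (true  ∷ T) (false ∷ Z) (true ∷ x)  p q = ─-⊑ T Z x p q
─-⊑ (false ∷ T) (true  ∷ Z) (true ∷ x)  p q = ─-⊑ T Z x p q
─-⊑ (false ∷ T) (false ∷ Z) (_ ∷ x)     p q = ─-⊑ T Z x p q

∪-⊑ : ∀ (Z Y T : Subset n) → Z ⊑ T ≡ true → Y ⊑ (T ─ Z) ≡ true → (Z ∪ Y) ⊑ T ≡ true
∪-⊑ []          []          []          p q = refl
∪-⊑ (true  ∷ Z) (false ∷ Y) (true  ∷ T) p q = ∪-⊑ Z Y T p q
∪-⊑ (false ∷ Z) (true  ∷ Y) (true  ∷ T) p q = ∪-⊑ Z Y T p q
∪-⊑ (false ∷ Z) (false ∷ Y) (_     ∷ T) p q = ∪-⊑ Z Y T p q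

∣∪∣-disjoint : ∀ (Z Y T : Subset n) → Y ⊑ (T ─ Z) ≡ true → ∣ Z ∪ Y ∣ ≡ ∣ Z ∣ + ∣ Y ∣
∣∪∣-disjoint []          []          []          q = refl
∣∪∣-disjoint (true  ∷ Z) (false ∷ Y) (_     ∷ T) q = cong suc (∣∪∣-disjoint Z Y T q)
∣∪∣-disjoint (false ∷ Z) (true  ∷ Y) (true  ∷ T) q =
  trans (cong suc (∣∪∣-disjoint Z Y T q)) (sym (+-suc ∣ Z ∣ ∣ Y ∣))
∣∪∣-disjoint (false ∷ Z) (false ∷ Y) (_     ∷ T) q = ∣∪∣-disjoint Z Y T q

largest : {P : Subset n → Set} → Decidable P → ∃ P →
  ∃[ Z ] P Z × (∀ Y → ∣ Z ∣ < ∣ Y ∣ → ¬ P Y)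
largest {n} {P} P? (Z , pZ) = search n Z pZ (m≤m+n n ∣ Z ∣)
  where
  search : ∀ fuel Z → P Z → n ≤ fuel + ∣ Z ∣ → ∃[ Z ] P Z × (∀ Y → ∣ Z ∣ < ∣ Y ∣ → ¬ P Y)
  search fuel Z pZ enough with anySubset? (λ Y → ∣ Z ∣ <? ∣ Y ∣ ×-dec P? Y)
  ... | no none = Z , pZ , λ Y Z<Y pY → none (Y , Z<Y , pY)
  search zero Z pZ enough | yes (Y , Z<Y , pY) =
    contradiction (≤-trans Z<Y (≤-trans (∣p∣≤n Y) enough)) 1+n≰n
  search (suc fuel) Z pZ enough | yes (Y , Z<Y , pY) =
    search fuel Y pY (≤-trans enough (≤-trans (≤-reflexive (sym (+-suc fuel ∣ Z ∣))) (+-monoʳ-≤ fuel Z<Y)))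

filter-split : ∀ (p : A → Bool) F → F ↭ filterᵇ p F ++ filterᵇ (not ∘ p) F
filter-split p []      = ↭.refl
filter-split p (a ∷ F) with p a
... | true  = ↭.prep a (filter-split p F)
... | false = ↭.↭-trans (↭.prep a (filter-split p F)) (↭.↭-sym (shift a (filterᵇ p F) (filterᵇ (not ∘ p) F)))

any-↭ : ∀ (p : A → Bool) {F G} → F ↭ G → any p F ≡ any p G
any-↭ p ↭.refl         = refl
any-↭ p (↭.prep a F↭G) = cong (p a ∨_) (any-↭ p F↭G)
any-↭ p (↭.swap {F} {G} a c F↭G) = begin
  p a ∨ (p c ∨ any p F)  ≡⟨ Bool.∨-assoc (p a) (p c) _ ⟨
  (p a ∨ p c) ∨ any p F  ≡⟨ cong₂ _∨_ (Bool.∨-comm (p a) (p c)) (any-↭ p F↭G) ⟩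
  (p c ∨ p a) ∨ any p G  ≡⟨ Bool.∨-assoc (p c) (p a) _ ⟩
  p c ∨ (p a ∨ any p G)  ∎
  where open ≡-Reasoning
any-↭ p (↭.trans F↭G G↭H) = trans (any-↭ p F↭G) (any-↭ p G↭H)

any-++ : ∀ (p : A → Bool) F G → any p (F ++ G) ≡ any p F ∨ any p G
any-++ p []      G = refl
any-++ p (a ∷ F) G = trans (cong (p a ∨_) (any-++ p F G)) (sym (Bool.∨-assoc (p a) _ _))

any-mono : ∀ {p q : A → Bool} F → (∀ a → p a ≡ true → q a ≡ true) → any p F ≡ true → any q F ≡ true
any-mono {p = p} {q} (a ∷ F) p⇒q h with p a in pa
... | true  rewrite p⇒q a pa = refl
... | false with q a
...   | true  = refl
...   | false = any-mono F p⇒q h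

𝟙-not-anti : ∀ {a c} → (a ≡ true → c ≡ true) → 𝟙 (not c) ≤ 𝟙 (not a)
𝟙-not-anti {a} {true}       a⇒c = z≤n
𝟙-not-anti {true} {false}  a⇒c = contradiction (a⇒c refl) λ ()
𝟙-not-anti {false} {false} a⇒c = ≤-refl

∑-↭ : ∀ {F G : List A} (f : A → ℕ) → F ↭ G → ∑ F f ≡ ∑ G f
∑-↭ f F↭G = sum-↭ (map⁺ f F↭G)

∑-++ : ∀ (F G : List A) f → ∑ (F ++ G) f ≡ ∑ F f + ∑ G f
∑-++ F G f = trans (cong sum (map-++ f F G)) (sum-++ (map f F) (map f G))

∑-filter : ∀ (p : A → Bool) F f → ∑ (filterᵇ p F) f ≡ ∑ F (λ a → f a * 𝟙 (p a))
∑-filter p []      f = refl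
∑-filter p (a ∷ F) f with p a
... | true  = cong₂ _+_ (sym (*-identityʳ (f a))) (∑-filter p F f)
... | false = cong₂ _+_ (sym (*-zeroʳ (f a))) (∑-filter p F f)

holds : List (Subset n) → Cube n → Bool
holds F x = any (_⊑ x) F

Narrow : ℕ → List (Subset n) → Set
Narrow w = All (λ T → ∣ T ∣ ≤ w)

all-filterᵇ : ∀ (p : A → Bool) F → All (λ a → p a ≡ true) (filterᵇ p F)
all-filterᵇ p []      = []
all-filterᵇ p (a ∷ F) with p a in pa
... | true  = pa ∷ all-filterᵇ p F
... | false = all-filterᵇ p F

disagree : Bool → Bool → ℕ
disagree a c = 𝟙 (a xor c)

disagree-refl : ∀ a → disagree a a ≡ 0
disagree-refl true  = refl
disagree-refl false = refl

disagree-triangle : ∀ a c e → disagree a e ≤ disagree a c + disagree c e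
disagree-triangle true  true  e     = ≤-refl
disagree-triangle false false e     = ≤-refl
disagree-triangle true  false true  = z≤n
disagree-triangle true  false false = ≤-refl
disagree-triangle false true  true  = ≤-refl
disagree-triangle false true  false = z≤n

core-approximates : ∀ t g r {z} → (t ≡ true → z ≡ true) → (g ≡ true → z ≡ true) →
  (t ∨ g ∨ r) ≤ᵇ (z ∨ r) × disagree (z ∨ r) (t ∨ g ∨ r) ≤ 𝟙 (z ∧ not g)
core-approximates false false r     {false} _ _ = Bool.≤-refl , ≤-reflexive (disagree-refl r)
core-approximates t     true  r     {false} _ g⇒z = contradiction (g⇒z refl) λ ()
core-approximates true  false r     {false} t⇒z _ = contradiction (t⇒z refl) λ ()
core-approximates t     false r     {true}  _ _ = Bool.≤-maximum _ , 𝟙≤1 _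
core-approximates true  true  r     {true}  _ _ = Bool.≤-maximum _ , z≤n
core-approximates false true  r     {true}  _ _ = Bool.≤-maximum _ , z≤n

petals-approximate : ∀ t g r {z} → (t ≡ true → z ≡ true) →
  (g ∨ r) ≤ᵇ (t ∨ g ∨ r) × disagree (g ∨ r) (t ∨ g ∨ r) ≤ 𝟙 (z ∧ not g)
petals-approximate false g     r     _   = Bool.≤-refl , ≤-trans (≤-reflexive (disagree-refl (g ∨ r))) z≤n
petals-approximate true  true  r     _   = Bool.≤-maximum _ , z≤n
petals-approximate true  false r     t⇒z rewrite t⇒z refl = Bool.≤-maximum _ , 𝟙≤1 _

module _ (w : ℕ) .{{_ : NonZero w}} (b : ℕ) where

  J K : ℕ
  J = 3 * w
  K = 2 * (suc b * J)

  instance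
    J≢0 : NonZero J
    J≢0 = m*n≢0 3 w
    K≢0 : NonZero K
    K≢0 = m*n≢0 2 (suc b * J) {{_}} {{m*n≢0 (suc b) J}}

  weight : Subset n → ℕ
  weight T = K ^ (w ∸ ∣ T ∣)

  load : List (Subset n) → Subset n → ℕ
  load F Z = ∑ F (λ T → weight T * 𝟙 (Z ⊑ T))

  -- The factor 2 leaves the core heavy after the loss of one petal.
  Heavy : List (Subset n) → Subset n → Set
  Heavy F Z = 2 * K ^ w < K ^ ∣ Z ∣ * load F Z

  light⇒short : (F : List (Subset n)) → ¬ Heavy F ⊥ → length F ≤ 2 * K ^ w
  light⇒short {n} F light = begin
    length F                  ≤⟨ length≤load F ⟩
    load F ⊥                  ≡⟨ *-identityˡ _ ⟨
    1 * load F ⊥              ≡⟨ cong (λ e → K ^ e * load F ⊥) (∣⊥∣≡0 n) ⟨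
    K ^ ∣ ⊥ {n} ∣ * load F ⊥  ≤⟨ ≮⇒≥ light ⟩
    2 * K ^ w                 ∎
    where
    open ≤-Reasoning
    length≤load : ∀ F → length F ≤ load F ⊥
    length≤load []      = z≤n
    length≤load (T ∷ F) rewrite ⊥-⊑ T =
      +-mono-≤ (≤-trans (m^n>0 K (w ∸ ∣ T ∣)) (≤-reflexive (sym (*-identityʳ _)))) (length≤load F)

  module _ (k : ℕ) (half : suc b ^ k ≤ 2 * b ^ k) where

    record Sunflower (F : List (Subset n)) : Set where
      field
        core petal    : Subset n
        petals others : List (Subset n)
        split         : F ↭ petal ∷ petals ++ others
        core⊑petal    : core ⊑ petal ≡ true
        core⊑petals   : All (λ T → core ⊑ T ≡ true) petals
        nonempty      : 1 ≤ length petals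
        failure       : mass 1 (λ x → 𝟙 (core ⊑ x ∧ not (holds petals x))) * 2 ^ k ≤ 2 ^ n

    heavy⇒sunflower : (F : List (Subset n)) → Narrow w F → Heavy F ⊥ → Sunflower F
    heavy⇒sunflower {n} F narrow heavy-⊥ with largest (λ Z → 2 * K ^ w <? K ^ ∣ Z ∣ * load F Z) (⊥ , heavy-⊥)
    ... | Z , heavy , maximal
        with filterᵇ (Z ⊑_) F | all-filterᵇ (Z ⊑_) F | filter-split (Z ⊑_) F | ∑-filter (Z ⊑_) F weight
    ...   | [] | _ | _ | no-load =
      contradiction (subst (λ s → 2 * K ^ w < K ^ ∣ Z ∣ * s) (sym no-load) heavy)
        (λ h → n≮0 (subst (2 * K ^ w <_) (*-zeroʳ (K ^ ∣ Z ∣)) h))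
    ...   | T ∷ G | Z⊑T ∷ Z⊑G | F↭ | loaded = record
      { core        = Z
      ; petal       = T
      ; petals      = G
      ; others      = filterᵇ (not ∘ (Z ⊑_)) F
      ; split       = F↭
      ; core⊑petal  = Z⊑T
      ; core⊑petals = Z⊑G
      ; nonempty    = nonempty G μ>0
      ; failure     = ≤-trans (*-monoˡ-≤ (2 ^ k) (mass-mono 1 bad≤))
          (amplify-half b k half g (λ x → 𝟙≤1 _) antitone
            (spread⇒satisfied b w G (_─ Z) weight narrow-petals {{>-nonZero μ>0}} spread))
      }
      where
      open ≤-Reasoning
      μ = ∑ G weight
      g : Cube n → ℕ
      g x = 𝟙 (not (any (λ S → (S ─ Z) ⊑ x) G))

      narrow′ : Narrow w (T ∷ G ++ filterᵇ (not ∘ (Z ⊑_)) F)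
      narrow′ = All-resp-↭ F↭ narrow

      narrow-petals : ∀ {S} → S ∈ G → ∣ S ─ Z ∣ ≤ w
      narrow-petals {S} S∈G =
        ≤-trans (∣─∣≤ S Z) (All.lookup (All.++⁻ˡ G (All.tail narrow′)) S∈G)

      petal-light : K ^ ∣ Z ∣ * weight T ≤ K ^ w
      petal-light = begin
        K ^ ∣ Z ∣ * weight T         ≤⟨ *-monoˡ-≤ (weight T) (^-monoʳ-≤ K (⊑⇒∣∣≤ Z T Z⊑T)) ⟩
        K ^ ∣ T ∣ * weight T         ≡⟨ ^-distribˡ-+-* K ∣ T ∣ (w ∸ ∣ T ∣) ⟨
        K ^ (∣ T ∣ + (w ∸ ∣ T ∣))    ≡⟨ cong (K ^_) (m+[n∸m]≡n (All.head narrow′)) ⟩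
        K ^ w                        ∎

      core-heavy : K ^ w < K ^ ∣ Z ∣ * μ
      core-heavy = +-cancelˡ-< (K ^ w) _ _ (begin-strict
        K ^ w + K ^ w                           ≡⟨ cong (K ^ w +_) (+-identityʳ (K ^ w)) ⟨
        2 * K ^ w                               <⟨ heavy ⟩
        K ^ ∣ Z ∣ * load F Z                    ≡⟨ cong (K ^ ∣ Z ∣ *_) loaded ⟨
        K ^ ∣ Z ∣ * (weight T + μ)              ≡⟨ *-distribˡ-+ (K ^ ∣ Z ∣) (weight T) μ ⟩
        K ^ ∣ Z ∣ * weight T + K ^ ∣ Z ∣ * μ    ≤⟨ +-monoˡ-≤ _ petal-light ⟩
        K ^ w + K ^ ∣ Z ∣ * μ                   ∎)

      μ>0 : 0 < μ
      μ>0 = n≢0⇒n>0 λ μ≡0 →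
        n≮0 (subst (K ^ w <_) (trans (cong (K ^ ∣ Z ∣ *_) μ≡0) (*-zeroʳ (K ^ ∣ Z ∣))) core-heavy)

      nonempty : ∀ G → 0 < ∑ G weight → 1 ≤ length G
      nonempty (_ ∷ _) _ = s≤s z≤n

      petal-load : Subset n → ℕ
      petal-load Y = ∑ G (λ S → weight S * 𝟙 (Y ⊑ (S ─ Z)))

      petal-load≤load : ∀ Y → petal-load Y ≤ load F (Z ∪ Y)
      petal-load≤load Y = begin
        petal-load Y
          ≤⟨ ∑-mono G (λ {S} S∈G → *-monoʳ-≤ (weight S) (pointwise S (All.lookup Z⊑G S∈G))) ⟩
        ∑ G f
          ≤⟨ m≤m+n (∑ G f) _ ⟩
        ∑ G f + ∑ (filterᵇ (not ∘ (Z ⊑_)) F) f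
          ≡⟨ ∑-++ G _ f ⟨
        ∑ (G ++ filterᵇ (not ∘ (Z ⊑_)) F) f
          ≤⟨ m≤n+m _ (f T) ⟩
        ∑ (T ∷ G ++ filterᵇ (not ∘ (Z ⊑_)) F) f
          ≡⟨ ∑-↭ f F↭ ⟨
        load F (Z ∪ Y) ∎
        where
        f : Subset n → ℕ
        f S = weight S * 𝟙 ((Z ∪ Y) ⊑ S)
        pointwise : ∀ S → Z ⊑ S ≡ true → 𝟙 (Y ⊑ (S ─ Z)) ≤ 𝟙 ((Z ∪ Y) ⊑ S)
        pointwise S Z⊑S with Y ⊑ (S ─ Z) in Y⊑
        ... | false = z≤n
        ... | true rewrite ∪-⊑ Z Y S Z⊑S Y⊑ = ≤-refl

      petal-load-unless : ∀ Y H → (∀ S → Y ⊑ (S ─ Z) ≡ false) →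
        ∑ H (λ S → weight S * 𝟙 (Y ⊑ (S ─ Z))) ≡ 0
      petal-load-unless Y []      none = refl
      petal-load-unless Y (S ∷ H) none rewrite none S =
        cong₂ _+_ (*-zeroʳ (weight S)) (petal-load-unless Y H none)

      spread-disjoint : ∀ Y → ∣ Z ∪ Y ∣ ≡ ∣ Z ∣ + ∣ Y ∣ → (suc b * J) ^ ∣ Y ∣ * petal-load Y ≤ μ
      spread-disjoint Y disjoint with ∣ Y ∣
      ... | zero = begin
        1 * petal-load Y  ≡⟨ *-identityˡ _ ⟩
        petal-load Y      ≤⟨ ∑-mono G (λ {S} _ →
                               ≤-trans (*-monoʳ-≤ (weight S) (𝟙≤1 _)) (≤-reflexive (*-identityʳ _))) ⟩
        μ                 ∎
      ... | suc y = *-cancelˡ-≤ (2 * K ^ ∣ Z ∣) {{m*n≢0 2 _ {{_}} {{m^n≢0 K ∣ Z ∣}}}} (begin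
        2 * K ^ ∣ Z ∣ * (c ^ suc y * petal-load Y)
          ≤⟨ *-monoʳ-≤ (2 * K ^ ∣ Z ∣) (*-monoˡ-≤ (petal-load Y) (*-monoʳ-≤ c (^-monoˡ-≤ y (m≤m+n c (c + 0))))) ⟩
        2 * K ^ ∣ Z ∣ * (c * K ^ y * petal-load Y)
          ≡⟨ regroup (K ^ ∣ Z ∣) c (K ^ y) (petal-load Y) ⟩
        K ^ ∣ Z ∣ * (K * K ^ y) * petal-load Y
          ≡⟨ cong (_* petal-load Y) (^-distribˡ-+-* K ∣ Z ∣ (suc y)) ⟨
        K ^ (∣ Z ∣ + suc y) * petal-load Y
          ≡⟨ cong (λ e → K ^ e * petal-load Y) disjoint ⟨
        K ^ ∣ Z ∪ Y ∣ * petal-load Y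
          ≤⟨ *-monoʳ-≤ (K ^ ∣ Z ∪ Y ∣) (petal-load≤load Y) ⟩
        K ^ ∣ Z ∪ Y ∣ * load F (Z ∪ Y)
          ≤⟨ ≮⇒≥ (maximal (Z ∪ Y) (subst (∣ Z ∣ <_) (sym disjoint) (m<m+n ∣ Z ∣ (s≤s z≤n)))) ⟩
        2 * K ^ w
          ≤⟨ *-monoʳ-≤ 2 (<⇒≤ core-heavy) ⟩
        2 * (K ^ ∣ Z ∣ * μ)
          ≡⟨ *-assoc 2 (K ^ ∣ Z ∣) μ ⟨
        2 * K ^ ∣ Z ∣ * μ ∎)
        where
        c = suc b * J
        regroup : ∀ z c p s → 2 * z * (c * p * s) ≡ z * (2 * c * p) * s
        regroup = solve-∀

      spread : ∀ Y → (suc b * J) ^ ∣ Y ∣ * petal-load Y ≤ μ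
      spread Y with Y ⊑ (⊤ ─ Z) in Y⊑
      ... | true  = spread-disjoint Y (∣∪∣-disjoint Z Y ⊤ Y⊑)
      ... | false = subst (λ s → (suc b * J) ^ ∣ Y ∣ * s ≤ μ)
        (sym (petal-load-unless Y G (λ S → false-mono (outside-core S Y Z) Y⊑)))
        (≤-trans (≤-reflexive (*-zeroʳ ((suc b * J) ^ ∣ Y ∣))) z≤n)
        where
        outside-core : ∀ {n} (S Y Z : Subset n) → Y ⊑ (S ─ Z) ≡ true → Y ⊑ (⊤ ─ Z) ≡ true
        outside-core []      []          []          _ = refl
        outside-core (true ∷ S) (true  ∷ Y) (false ∷ Z) p = outside-core S Y Z p
        outside-core (false ∷ S) (true ∷ Y) (true ∷ Z) ()
        outside-core (false ∷ S) (true ∷ Y) (false ∷ Z) ()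
        outside-core (_ ∷ S) (false ∷ Y) (_     ∷ Z) p = outside-core S Y Z p
        false-mono : ∀ {a c} → (a ≡ true → c ≡ true) → c ≡ false → a ≡ false
        false-mono {false} _   _      = refl
        false-mono {true}  a⇒c refl = sym (a⇒c refl)

      antitone : Antitone g
      antitone x y x⊑y = 𝟙-not-anti (any-mono G (λ S p → ⊑-trans (S ─ Z) x y p x⊑y))

      bad≤ : ∀ x → 𝟙 (Z ⊑ x ∧ not (holds G x)) ≤ g x
      bad≤ x with Z ⊑ x in Z⊑x
      ... | false = z≤n
      ... | true  = 𝟙-not-anti (any-mono G (λ S p → ─-⊑ S Z x Z⊑x p))

    record Approximates (_∼_ : Rel Bool _) (m : ℕ) (F′ F : List (Subset n)) : Set where
      field
        narrow  : Narrow w F′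
        related : ∀ x → holds F′ x ∼ holds F x
        error   : mass 1 (λ x → disagree (holds F′ x) (holds F x)) * 2 ^ k ≤ m * 2 ^ n

    Step : Rel Bool _ → Set
    Step _∼_ = ∀ {n} (F : List (Subset n)) → Narrow w F → Sunflower F →
      ∃[ F′ ] length F′ < length F × Approximates _∼_ 1 F′ F

    holds-split : {F : List (Subset n)} (s : Sunflower F) → let open Sunflower s in ∀ x →
      holds F x ≡ petal ⊑ x ∨ holds petals x ∨ holds others x
    holds-split s x = trans (any-↭ (_⊑ x) split) (cong (petal ⊑ x ∨_) (any-++ (_⊑ x) petals others))
      where open Sunflower s

    length-split : {F : List (Subset n)} (s : Sunflower F) → let open Sunflower s in
      length F ≡ suc (length petals + length others)
    length-split s = trans (↭-length split) (cong suc (length-++ petals))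
      where open Sunflower s

    petals⇒core : {F : List (Subset n)} (s : Sunflower F) → let open Sunflower s in ∀ x →
      holds petals x ≡ true → core ⊑ x ≡ true
    petals⇒core s x = go petals core⊑petals
      where
      open Sunflower s
      go : ∀ G → All (λ T → core ⊑ T ≡ true) G → holds G x ≡ true → core ⊑ x ≡ true
      go (T ∷ G) (core⊑T ∷ core⊑G) h with T ⊑ x in T⊑x
      ... | true  = ⊑-trans core T x core⊑T T⊑x
      ... | false = go G core⊑G h

    step-error : {F F′ : List (Subset n)} (s : Sunflower F) → let open Sunflower s in
      (∀ x → disagree (holds F′ x) (holds F x) ≤ 𝟙 (core ⊑ x ∧ not (holds petals x))) →
      mass 1 (λ x → disagree (holds F′ x) (holds F x)) * 2 ^ k ≤ 1 * 2 ^ n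
    step-error {n} s bound = ≤-trans (*-monoˡ-≤ (2 ^ k) (mass-mono 1 bound))
      (≤-trans (Sunflower.failure s) (≤-reflexive (sym (*-identityˡ (2 ^ n)))))

    upper-step : Step (flip _≤ᵇ_)
    upper-step F narrow s = core ∷ others , shorter , record
      { narrow  = ≤-trans (⊑⇒∣∣≤ core petal core⊑petal) (All.head narrow′) ∷ All.++⁻ʳ petals (All.tail narrow′)
      ; related = λ x → proj₁ (pointwise x)
      ; error   = step-error {F′ = core ∷ others} s (λ x → proj₂ (pointwise x))
      }
      where
      open Sunflower s
      narrow′ = All-resp-↭ split narrow
      shorter : suc (length others) < length F
      shorter = subst (suc (length others) <_) (sym (length-split s)) (s≤s (+-monoˡ-≤ (length others) nonempty))
      pointwise : ∀ x → holds F x ≤ᵇ holds (core ∷ others) x ×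
        disagree (holds (core ∷ others) x) (holds F x) ≤ 𝟙 (core ⊑ x ∧ not (holds petals x))
      pointwise x rewrite holds-split s x =
        core-approximates (petal ⊑ x) (holds petals x) (holds others x)
          (⊑-trans core petal x core⊑petal) (petals⇒core s x)

    lower-step : Step _≤ᵇ_
    lower-step F narrow s = petals ++ others , shorter , record
      { narrow  = All.tail (All-resp-↭ split narrow)
      ; related = λ x → proj₁ (pointwise x)
      ; error   = step-error {F′ = petals ++ others} s (λ x → proj₂ (pointwise x))
      }
      where
      open Sunflower s
      shorter : length (petals ++ others) < length F
      shorter = ≤-reflexive (trans (cong suc (length-++ petals)) (sym (length-split s)))
      pointwise : ∀ x → holds (petals ++ others) x ≤ᵇ holds F x ×
        disagree (holds (petals ++ others) x) (holds F x) ≤ 𝟙 (core ⊑ x ∧ not (holds petals x))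
      pointwise x rewrite holds-split s x | any-++ (_⊑ x) petals others =
        petals-approximate (petal ⊑ x) (holds petals x) (holds others x) (⊑-trans core petal x core⊑petal)

    sparsify : ∀ {_∼_ : Rel Bool _} → Reflexive _∼_ → Transitive _∼_ → Step _∼_ →
      ∀ m (F : List (Subset n)) → length F ≤ m → Narrow w F →
      ∃[ F′ ] length F′ ≤ 2 * K ^ w × Approximates _∼_ m F′ F
    sparsify {n} {_∼_} ∼-refl ∼-trans step m F F≤m narrow
      with 2 * K ^ w <? K ^ ∣ ⊥ {n} ∣ * load F ⊥
    ... | no light = F , light⇒short F light , record
      { narrow  = narrow
      ; related = λ x → ∼-refl
      ; error   = ≤-trans (≤-reflexive (cong (_* 2 ^ k)
          (trans (mass-cong 1 (λ x → disagree-refl (holds F x))) (mass-zero n 1)))) z≤n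
      }
    ... | yes heavy with step F narrow (heavy⇒sunflower F narrow heavy)
    ...   | F′ , F′<F , close = continue m F≤m
      where
      continue : ∀ m → length F ≤ m → ∃[ F″ ] length F″ ≤ 2 * K ^ w × Approximates _∼_ m F″ F
      continue zero    F≤0 = contradiction (≤-trans F′<F F≤0) n≮0
      continue (suc m) F≤1+m
        with sparsify ∼-refl ∼-trans step m F′ (s≤s⁻¹ (≤-trans F′<F F≤1+m)) (Approximates.narrow close)
      ... | F″ , short , closer = F″ , short , record
        { narrow  = Approximates.narrow closer
        ; related = λ x → ∼-trans (Approximates.related closer x) (Approximates.related close x)
        ; error   = begin
            mass 1 (λ x → disagree (holds F″ x) (holds F x)) * 2 ^ k
              ≤⟨ *-monoˡ-≤ (2 ^ k) (mass-mono 1 (λ x → disagree-triangle (holds F″ x) (holds F′ x) (holds F x))) ⟩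
            mass 1 (λ x → far x + near x) * 2 ^ k
              ≡⟨ cong (_* 2 ^ k) (mass-+ 1 far near) ⟩
            (mass 1 far + mass 1 near) * 2 ^ k
              ≡⟨ *-distribʳ-+ (2 ^ k) (mass 1 far) (mass 1 near) ⟩
            mass 1 far * 2 ^ k + mass 1 near * 2 ^ k
              ≤⟨ +-mono-≤ (Approximates.error closer) (Approximates.error close) ⟩
            m * 2 ^ n + 1 * 2 ^ n
              ≡⟨ trans (cong (m * 2 ^ n +_) (*-identityˡ (2 ^ n))) (+-comm (m * 2 ^ n) (2 ^ n)) ⟩
            suc m * 2 ^ n ∎
        }
        where
        open ≤-Reasoning
        far near : Cube n → ℕ
        far x  = disagree (holds F″ x) (holds F′ x)
        near x = disagree (holds F′ x) (holds F x)

agreesWith : Bool → Bool → Bool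
agreesWith s b = if s then b else not b

agree : Cube n → Cube n → Cube n
agree = zipWith agreesWith

mass-agree : ∀ (s : Cube n) g → mass 1 (g ∘ agree s) ≡ mass 1 g
mass-agree []          g = refl
mass-agree (true ∷ s)  g =
  cong₂ (λ u v → 1 * u + v) (mass-agree s (g ∘ (false ∷_))) (mass-agree s (g ∘ (true ∷_)))
mass-agree (false ∷ s) g = begin
  1 * mass 1 (g ∘ (true ∷_) ∘ agree s) + mass 1 (g ∘ (false ∷_) ∘ agree s)
    ≡⟨ cong₂ (λ u v → 1 * u + v) (mass-agree s (g ∘ (true ∷_))) (mass-agree s (g ∘ (false ∷_))) ⟩
  1 * mass 1 (g ∘ (true ∷_)) + mass 1 (g ∘ (false ∷_))
    ≡⟨ exchange (mass 1 (g ∘ (true ∷_))) (mass 1 (g ∘ (false ∷_))) ⟩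
  1 * mass 1 (g ∘ (false ∷_)) + mass 1 (g ∘ (true ∷_)) ∎
  where
  open ≡-Reasoning
  exchange : ∀ u v → 1 * u + v ≡ 1 * v + u
  exchange = solve-∀

shiftLiteral : Literal n → Literal (suc n)
shiftLiteral (pos i) = pos (suc i)
shiftLiteral (neg i) = neg (suc i)

signedTerm : Cube n → Subset n → Term n
signedTerm []      []          = []
signedTerm (b ∷ s) (true ∷ S)  = (if b then pos zero else neg zero) ∷ map shiftLiteral (signedTerm s S)
signedTerm (_ ∷ s) (false ∷ S) = map shiftLiteral (signedTerm s S)

evalTerm-shift : ∀ (t : Term n) b x → evalTerm (map shiftLiteral t) (b ∷ x) ≡ evalTerm t x
evalTerm-shift []          b x = refl
evalTerm-shift (pos i ∷ t) b x = cong (lookup x i ∧_) (evalTerm-shift t b x)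
evalTerm-shift (neg i ∷ t) b x = cong (not (lookup x i) ∧_) (evalTerm-shift t b x)

evalTerm-signedTerm : ∀ (s : Cube n) S x → evalTerm (signedTerm s S) x ≡ S ⊑ agree s x
evalTerm-signedTerm []          []          []      = refl
evalTerm-signedTerm (true ∷ s)  (true ∷ S)  (b ∷ x) =
  cong (b ∧_) (trans (evalTerm-shift (signedTerm s S) b x) (evalTerm-signedTerm s S x))
evalTerm-signedTerm (false ∷ s) (true ∷ S)  (b ∷ x) =
  cong (not b ∧_) (trans (evalTerm-shift (signedTerm s S) b x) (evalTerm-signedTerm s S x))
evalTerm-signedTerm (_ ∷ s)     (false ∷ S) (b ∷ x) =
  trans (evalTerm-shift (signedTerm s S) b x) (evalTerm-signedTerm s S x)

length-signedTerm : ∀ (s : Cube n) S → length (signedTerm s S) ≡ ∣ S ∣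
length-signedTerm []      []          = refl
length-signedTerm (_ ∷ s) (true ∷ S)  =
  cong suc (trans (length-map shiftLiteral (signedTerm s S)) (length-signedTerm s S))
length-signedTerm (_ ∷ s) (false ∷ S) =
  trans (length-map shiftLiteral (signedTerm s S)) (length-signedTerm s S)

signedDNF : Cube n → List (Subset n) → DNF n
signedDNF s = map (signedTerm s)

⟦signedDNF⟧ : ∀ (s : Cube n) F x → ⟦ signedDNF s F ⟧ x ≡ holds F (agree s x)
⟦signedDNF⟧ s []      x = refl
⟦signedDNF⟧ s (S ∷ F) x = cong₂ _∨_ (evalTerm-signedTerm s S x) (⟦signedDNF⟧ s F x)

width-signedDNF : ∀ {w} (s : Cube n) F → Narrow w F → width (signedDNF s F) ≤ w
width-signedDNF s []      []            = z≤n
width-signedDNF s (S ∷ F) (S≤w ∷ F≤w) =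
  ⊔-lub (≤-trans (≤-reflexive (length-signedTerm s S)) S≤w) (width-signedDNF s F F≤w)

index : Literal n → Fin n
index (pos i) = i
index (neg i) = i

support : Term n → Subset n
support []      = ⊥
support (l ∷ t) = ⁅ index l ⁆ ∪ support t

supports : DNF n → List (Subset n)
supports = map support

∣∪∣≤ : ∀ (S T : Subset n) → ∣ S ∪ T ∣ ≤ ∣ S ∣ + ∣ T ∣
∣∪∣≤ []          []          = z≤n
∣∪∣≤ (true ∷ S)  (true ∷ T)  = s≤s (≤-trans (∣∪∣≤ S T) (+-monoʳ-≤ ∣ S ∣ (n≤1+n ∣ T ∣)))
∣∪∣≤ (true ∷ S)  (false ∷ T) = s≤s (∣∪∣≤ S T)
∣∪∣≤ (false ∷ S) (true ∷ T)  = ≤-trans (s≤s (∣∪∣≤ S T)) (≤-reflexive (sym (+-suc ∣ S ∣ ∣ T ∣)))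
∣∪∣≤ (false ∷ S) (false ∷ T) = ∣∪∣≤ S T

∣support∣≤ : ∀ (t : Term n) → ∣ support t ∣ ≤ length t
∣support∣≤ {n} []      = ≤-reflexive (∣⊥∣≡0 n)
∣support∣≤     (l ∷ t) = ≤-trans (∣∪∣≤ ⁅ index l ⁆ (support t))
  (+-mono-≤ (≤-reflexive (∣⁅x⁆∣≡1 (index l))) (∣support∣≤ t))

supports-narrow : ∀ {w} (f : DNF n) → width f ≤ w → Narrow w (supports f)
supports-narrow []      _     = []
supports-narrow (t ∷ f) f≤w =
  ≤-trans (∣support∣≤ t) (m⊔n≤o⇒m≤o (length t) (width f) f≤w) ∷
  supports-narrow f (m⊔n≤o⇒n≤o (length t) (width f) f≤w)

∪-⊑-∧ : ∀ (S T x : Subset n) → (S ∪ T) ⊑ x ≡ S ⊑ x ∧ T ⊑ x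
∪-⊑-∧ []          []          []          = refl
∪-⊑-∧ (true ∷ S)  (true ∷ T)  (true ∷ x)  = ∪-⊑-∧ S T x
∪-⊑-∧ (true ∷ S)  (true ∷ T)  (false ∷ x) = refl
∪-⊑-∧ (true ∷ S)  (false ∷ T) (true ∷ x)  = ∪-⊑-∧ S T x
∪-⊑-∧ (true ∷ S)  (false ∷ T) (false ∷ x) = refl
∪-⊑-∧ (false ∷ S) (true ∷ T)  (true ∷ x)  = ∪-⊑-∧ S T x
∪-⊑-∧ (false ∷ S) (true ∷ T)  (false ∷ x) = sym (Bool.∧-zeroʳ (S ⊑ x))
∪-⊑-∧ (false ∷ S) (false ∷ T) (_ ∷ x)     = ∪-⊑-∧ S T x

⁅⁆-⊑ : ∀ (i : Fin n) x → ⁅ i ⁆ ⊑ x ≡ lookup x i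
⁅⁆-⊑ zero    (b ∷ x) = trans (cong (b ∧_) (⊥-⊑ x)) (Bool.∧-identityʳ b)
⁅⁆-⊑ (suc i) (_ ∷ x) = ⁅⁆-⊑ i x

_positiveIn?_ : (i : Fin n) (ls : List (Literal n)) → Dec (pos i ∈ ls)
i positiveIn? ls = any? (λ where
  (pos j) → map′ (cong pos) (λ { refl → refl }) (i Fin.≟ j)
  (neg j) → no λ ()) ls

signs : DNF n → Cube n
signs f = tabulate (λ i → does (i positiveIn? concat f))

module _ (f : DNF n) (unate : Unate f) where

  evalLiteral-signs : ∀ l → l ∈ concat f → ∀ x →
    evalLiteral l x ≡ lookup (agree (signs f) x) (index l)
  evalLiteral-signs l l∈f x = sym (trans
    (lookup-zipWith agreesWith (index l) (signs f) x)
    (trans (cong (λ b → agreesWith b (lookup x (index l))) (lookup∘tabulate _ (index l))) (sign l l∈f)))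
    where
    sign : ∀ l → l ∈ concat f →
      agreesWith (does (index l positiveIn? concat f)) (lookup x (index l)) ≡ evalLiteral l x
    sign (pos i) l∈f rewrite dec-true (i positiveIn? concat f) l∈f = refl
    sign (neg i) l∈f rewrite dec-false (i positiveIn? concat f) (λ pos∈f → unate i (pos∈f , l∈f)) = refl

  evalTerm-support : ∀ t → (∀ {l} → l ∈ t → l ∈ concat f) → ∀ x →
    evalTerm t x ≡ support t ⊑ agree (signs f) x
  evalTerm-support []      _   x = sym (⊥-⊑ (agree (signs f) x))
  evalTerm-support (l ∷ t) t⊆f x = sym (trans
    (∪-⊑-∧ ⁅ index l ⁆ (support t) (agree (signs f) x))
    (cong₂ _∧_
      (trans (⁅⁆-⊑ (index l) (agree (signs f) x)) (sym (evalLiteral-signs l (t⊆f (here refl)) x)))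
      (sym (evalTerm-support t (t⊆f ∘ there) x))))

  holds-supports : ∀ x → ⟦ f ⟧ x ≡ holds (supports f) (agree (signs f) x)
  holds-supports x = go f (λ l∈ → l∈)
    where
    go : ∀ g → (∀ {l} → l ∈ concat g → l ∈ concat f) → ⟦ g ⟧ x ≡ holds (supports g) (agree (signs f) x)
    go []      _   = refl
    go (t ∷ g) g⊆f = cong₂ _∨_
      (evalTerm-support t (g⊆f ∘ ∈-++⁺ˡ) x) (go g (g⊆f ∘ ∈-++⁺ʳ t))

length-filter : ∀ {P : A → Set} (P? : Decidable P) xs → length (filter P? xs) ≡ ∑ xs (𝟙 ∘ does ∘ P?)
length-filter P? []       = refl
length-filter P? (x ∷ xs) with does (P? x)
... | true  = cong suc (length-filter P? xs)
... | false = length-filter P? xs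

∑-map : ∀ {B : Set} (h : A → B) xs f → ∑ (map h xs) f ≡ ∑ xs (f ∘ h)
∑-map h []       f = refl
∑-map h (x ∷ xs) f = cong (f (h x) +_) (∑-map h xs f)

∑-points : ∀ n (g : Cube n → ℕ) → ∑ (points n) g ≡ mass 1 g
∑-points zero    g = +-identityʳ (g [])
∑-points (suc n) g = begin
  ∑ (map (false ∷_) (points n) ++ map (true ∷_) (points n) ++ []) g
    ≡⟨ cong (λ ps → ∑ (map (false ∷_) (points n) ++ ps) g) (++-identityʳ _) ⟩
  ∑ (map (false ∷_) (points n) ++ map (true ∷_) (points n)) g
    ≡⟨ ∑-++ (map (false ∷_) (points n)) _ g ⟩
  ∑ (map (false ∷_) (points n)) g + ∑ (map (true ∷_) (points n)) g
    ≡⟨ cong₂ _+_ (half false) (half true) ⟩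
  mass 1 (g ∘ (false ∷_)) + mass 1 (g ∘ (true ∷_))
    ≡⟨ cong (_+ mass 1 (g ∘ (true ∷_))) (*-identityˡ _) ⟨
  mass 1 g ∎
  where
  open ≡-Reasoning
  half : ∀ b → ∑ (map (b ∷_) (points n)) g ≡ mass 1 (g ∘ (b ∷_))
  half b = trans (∑-map (b ∷_) (points n) g) (∑-points n (g ∘ (b ∷_)))

disagreements : ∀ (g h : Cube n → Bool) →
  length (filter (λ x → ¬? (g x Bool.≟ h x)) (points n)) ≡ mass 1 (λ x → disagree (g x) (h x))
disagreements {n} g h = trans (length-filter (λ x → ¬? (g x Bool.≟ h x)) (points n)) (trans (∑-points n _)
  (mass-cong 1 (λ x → xor-≟ (g x) (h x))))
  where
  xor-≟ : ∀ a c → 𝟙 (does (¬? (a Bool.≟ c))) ≡ disagree a c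
  xor-≟ true  true  = refl
  xor-≟ true  false = refl
  xor-≟ false true  = refl
  xor-≟ false false = refl

mass-coordinate : ∀ (i : Fin n) (h : Bool → ℕ) → h false + h true ≡ 1 →
  2 * mass 1 (λ x → h (lookup x i)) ≡ 2 ^ n
mass-coordinate {suc n} zero h sum≡1 = cong (2 *_) (begin
  1 * mass {n} 1 (λ _ → h false) + mass {n} 1 (λ _ → h true)
    ≡⟨ cong₂ (λ u v → 1 * u + v) (mass-const n 1 (h false)) (mass-const n 1 (h true)) ⟩
  1 * (2 ^ n * h false) + 2 ^ n * h true
    ≡⟨ cong (_+ 2 ^ n * h true) (*-identityˡ (2 ^ n * h false)) ⟩
  2 ^ n * h false + 2 ^ n * h true
    ≡⟨ *-distribˡ-+ (2 ^ n) (h false) (h true) ⟨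
  2 ^ n * (h false + h true)
    ≡⟨ trans (cong (2 ^ n *_) sum≡1) (*-identityʳ (2 ^ n)) ⟩
  2 ^ n ∎)
  where open ≡-Reasoning
mass-coordinate {suc n} (suc i) h sum≡1 = cong (2 *_) (begin
  1 * m + m  ≡⟨ +-comm (1 * m) m ⟩
  2 * m      ≡⟨ mass-coordinate i h sum≡1 ⟩
  2 ^ n      ∎)
  where
  open ≡-Reasoning
  m = mass {n} 1 (λ x → h (lookup x i))

mass-short-term : ∀ (t : Term n) → length t ≤ 1 → 2 * mass 1 (λ x → 𝟙 (not (evalTerm t x))) ≤ 2 ^ n
mass-short-term {n} []          _ = ≤-trans (≤-reflexive (cong (2 *_) (mass-zero n 1))) z≤n
mass-short-term (pos i ∷ [])    _ = ≤-reflexive (mass-coordinate i (λ b → 𝟙 (not (b ∧ true))) refl)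
mass-short-term (neg i ∷ [])    _ = ≤-reflexive (mass-coordinate i (λ b → 𝟙 (not (not b ∧ true))) refl)
mass-short-term (_ ∷ _ ∷ _)     (s≤s ())

fromℕ-mkℚ : ∀ k → fromℕ k ≡ mkℚ (ℤ.+ k) 0 (Coprimality.sym (1-coprimeTo k))
fromℕ-mkℚ k = ℚ.normalize-coprime (Coprimality.sym (1-coprimeTo k))

/-≤ : ∀ c q .{{_ : NonZero q}} {p d-1} .{coprime : Coprime p (suc d-1)} →
  c * suc d-1 ≤ p * q → ℤ.+ c / q ℚ.≤ mkℚ (ℤ.+ p) d-1 coprime
/-≤ c (suc q) {p} {d-1} cd≤pq =
  ℚ.toℚᵘ-cancel-≤ (ℚᵘ.≤-respˡ-≃ (ℚᵘ.≃-sym (ℚ.toℚᵘ-fromℚᵘ (ℚᵘ.mkℚᵘ (ℤ.+ c) q)))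
    (ℚᵘ.*≤* (subst₂ ℤ._≤_ (ℤ.pos-* c (suc d-1)) (ℤ.pos-* p (suc q)) (+≤+ cd≤pq))))

≤-/ : ∀ c q .{{_ : NonZero q}} {p d-1} .{coprime : Coprime p (suc d-1)} →
  p * q ≤ c * suc d-1 → mkℚ (ℤ.+ p) d-1 coprime ℚ.≤ ℤ.+ c / q
≤-/ c (suc q) {p} {d-1} pq≤cd =
  ℚ.toℚᵘ-cancel-≤ (ℚᵘ.≤-respʳ-≃ (ℚᵘ.≃-sym (ℚ.toℚᵘ-fromℚᵘ (ℚᵘ.mkℚᵘ (ℤ.+ c) q)))
    (ℚᵘ.*≤* (subst₂ ℤ._≤_ (ℤ.pos-* p (suc q)) (ℤ.pos-* c (suc d-1)) (+≤+ pq≤cd))))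

fromℕ-mono-≤ : ∀ {i j} → i ≤ j → fromℕ i ℚ.≤ fromℕ j
fromℕ-mono-≤ {i} {j} i≤j = subst (ℚ._≤ fromℕ j) (sym (fromℕ-mkℚ i)) (≤-/ j 1 (*-monoˡ-≤ 1 i≤j))

fromℕ-cancel-≤ : ∀ i j → fromℕ i ℚ.≤ fromℕ j → i ≤ j
fromℕ-cancel-≤ i j i≤j with subst₂ ℚ._≤_ (fromℕ-mkℚ i) (fromℕ-mkℚ j) i≤j
... | *≤* i≤j = ℤ.drop‿+≤+ (subst₂ ℤ._≤_ (ℤ.*-identityʳ (ℤ.+ i)) (ℤ.*-identityʳ (ℤ.+ j)) i≤j)

fromℕ-* : ∀ i j → fromℕ (i * j) ≡ fromℕ i ℚ.* fromℕ j
fromℕ-* i j = trans (cong (_/ 1) (ℤ.pos-* i j)) (sym (cong₂ ℚ._*_ (fromℕ-mkℚ i) (fromℕ-mkℚ j)))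

fromℕ-^ : ∀ i k → fromℕ (i ^ k) ≡ fromℕ i ^ℚ k
fromℕ-^ i zero    = refl
fromℕ-^ i (suc k) = trans (fromℕ-* i (i ^ k)) (cong (fromℕ i ℚ.*_) (fromℕ-^ i k))

fromℕ-nonNeg : ∀ i → NonNegative (fromℕ i)
fromℕ-nonNeg i = ℚ.nonNegative (fromℕ-mono-≤ {0} {i} z≤n)

^-mono-fromℕ : ∀ i k {q} → fromℕ i ℚ.≤ q → fromℕ (i ^ k) ℚ.≤ q ^ℚ k
^-mono-fromℕ i zero    i≤q = ℚ.≤-refl
^-mono-fromℕ i (suc k) {q} i≤q = begin
  fromℕ (i * i ^ k)          ≡⟨ fromℕ-* i (i ^ k) ⟩
  fromℕ i ℚ.* fromℕ (i ^ k)  ≤⟨ ℚ.*-monoʳ-≤-nonNeg (fromℕ (i ^ k)) {{fromℕ-nonNeg (i ^ k)}} i≤q ⟩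
  q ℚ.* fromℕ (i ^ k)        ≤⟨ ℚ.*-monoˡ-≤-nonNeg q {{q≥0}} (^-mono-fromℕ i k i≤q) ⟩
  q ℚ.* q ^ℚ k               ∎
  where
  open ℚ.≤-Reasoning
  q≥0 : NonNegative q
  q≥0 = ℚ.nonNegative (ℚ.≤-trans (fromℕ-mono-≤ {0} {i} z≤n) i≤q)

^-cancelʳ-≤ : ∀ b {i j} → 1 < b → b ^ i ≤ b ^ j → i ≤ j
^-cancelʳ-≤ b {i} {j} 1<b bⁱ≤bʲ = ≮⇒≥ λ j<i → <⇒≱ (^-monoʳ-< b 1<b j<i) bⁱ≤bʲ

log₂-lower : ∀ l {y} → fromℕ (2 ^ l) ℚ.≤ y → ∀ r .{{_ : NonNegative r}} →
  r IsUpperBoundOfLog₂ y → fromℕ l ℚ.≤ r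
log₂-lower l {y} 2ˡ≤y (mkℚ -[1+ _ ] _ _) {{()}} _
log₂-lower l {y} 2ˡ≤y r@(mkℚ (ℤ.+ a) b-1 _) yᵇ≤2ᵃ =
  /-≤ l 1 (≤-trans lb≤a (≤-reflexive (sym (*-identityʳ a))))
  where
  b = suc b-1
  lb≤a : l * b ≤ a
  lb≤a = ^-cancelʳ-≤ 2 ≤-refl (subst (_≤ 2 ^ a) (^-*-assoc 2 l b) (fromℕ-cancel-≤ ((2 ^ l) ^ b) (2 ^ a) (begin
    fromℕ ((2 ^ l) ^ b)  ≤⟨ ^-mono-fromℕ (2 ^ l) b 2ˡ≤y ⟩
    y ^ℚ b               ≤⟨ yᵇ≤2ᵃ ⟩
    fromℕ 2 ^ℚ a         ≡⟨ fromℕ-^ 2 a ⟨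
    fromℕ (2 ^ a)        ∎)))
    where open ℚ.≤-Reasoning

≤-/ε : ∀ i m {p-1 d-1} .{coprime : Coprime (suc p-1) (suc d-1)} →
  i * suc p-1 ≤ m * suc d-1 → fromℕ i ℚ.≤ m /ε mkℚ +[1+ p-1 ] d-1 coprime
≤-/ε i m {p-1} {d-1} {coprime} ip≤md = begin
  fromℕ i
    ≡⟨ fromℕ-mkℚ i ⟩
  mkℚ (ℤ.+ i) 0 (Coprimality.sym (1-coprimeTo i))
    ≤⟨ ≤-/ (m * d) (1 * p) (subst₂ _≤_
         (cong (i *_) (sym (*-identityˡ p))) (sym (*-identityʳ (m * d))) ip≤md) ⟩
  ℤ.+ (m * d) / (1 * p)
    ≡⟨ cong (_/ (1 * p)) (ℤ.pos-* m d) ⟩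
  mkℚ (ℤ.+ m) 0 (Coprimality.sym (1-coprimeTo m)) ℚ.* ℚ.1/ ε
    ≡⟨ cong (ℚ._* ℚ.1/ ε) (fromℕ-mkℚ m) ⟨
  m /ε ε ∎
  where
  open ℚ.≤-Reasoning
  p = suc p-1
  d = suc d-1
  ε = mkℚ +[1+ p-1 ] d-1 coprime

small-size : ∀ w y k {i} → i ≤ 1 → i ≤max[1,⟨ w ·log₂ y ⟩^ k ]
small-size w y k i≤1 r _ = ℚ.≤-trans (fromℕ-mono-≤ i≤1) (ℚ.p≤p⊔q 1ℚ ((fromℕ w ℚ.* r) ^ℚ k))

sparse-size≤ : ∀ w l .{{_ : NonZero w}} → 1 ≤ l → 2 ≤ w * l →
  2 * (2 * (2 * suc l * (3 * w))) ^ w ≤ (w * l) ^ (7 * w)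
sparse-size≤ w@(suc w-1) l 1≤l 2≤wl = begin
  2 * (2 * (2 * suc l * (3 * w))) ^ w  ≤⟨ *-mono-≤ 2≤vʷ (^-monoˡ-≤ w K≤v⁶) ⟩
  v ^ w * (v ^ 6) ^ w                  ≡⟨ cong (v ^ w *_) (^-*-assoc v 6 w) ⟩
  v ^ w * v ^ (6 * w)                  ≡⟨ ^-distribˡ-+-* v w (6 * w) ⟨
  v ^ (7 * w)                          ∎
  where
  open ≤-Reasoning
  v = w * l
  v≢0 : NonZero v
  v≢0 = >-nonZero (≤-trans (s≤s z≤n) 2≤wl)
  2≤vʷ : 2 ≤ v ^ w
  2≤vʷ = ≤-trans 2≤wl (m≤m*n v (v ^ w-1) {{m^n≢0 v w-1 {{v≢0}}}})
  rearrange : ∀ w l → 2 * (2 * (l + l) * (3 * w)) ≡ 24 * (w * l)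
  rearrange = solve-∀
  K≤v⁶ : 2 * (2 * suc l * (3 * w)) ≤ v ^ 6
  K≤v⁶ = begin
    2 * (2 * suc l * (3 * w))    ≤⟨ *-monoʳ-≤ 2 (*-monoˡ-≤ (3 * w) (*-monoʳ-≤ 2 (+-monoˡ-≤ l 1≤l))) ⟩
    2 * (2 * (l + l) * (3 * w))  ≡⟨ rearrange w l ⟩
    24 * v                       ≤⟨ *-monoˡ-≤ v (m≤m+n 24 8) ⟩
    2 ^ 5 * v                    ≤⟨ *-monoˡ-≤ v (^-monoˡ-≤ 5 2≤wl) ⟩
    v ^ 5 * v                    ≡⟨ *-comm (v ^ 5) v ⟩
    v ^ 6                        ∎

sparse-size : ∀ w l y {i} .{{_ : NonZero w}} → 1 ≤ l → 2 ≤ w * l → fromℕ (2 ^ l) ℚ.≤ y →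
  i ≤ 2 * (2 * (2 * suc l * (3 * w))) ^ w → i ≤max[1,⟨ w ·log₂ y ⟩^ 7 * w ]
sparse-size w l y {i} 1≤l 2≤wl 2ˡ≤y i≤ r y≤2ʳ = begin
  fromℕ i                       ≤⟨ fromℕ-mono-≤ (≤-trans i≤ (sparse-size≤ w l 1≤l 2≤wl)) ⟩
  fromℕ ((w * l) ^ (7 * w))     ≤⟨ ^-mono-fromℕ (w * l) (7 * w) wl≤wr ⟩
  (fromℕ w ℚ.* r) ^ℚ (7 * w)    ≤⟨ ℚ.p≤q⊔p 1ℚ _ ⟩
  1ℚ ℚ.⊔ (fromℕ w ℚ.* r) ^ℚ (7 * w) ∎
  where
  open ℚ.≤-Reasoning
  wl≤wr : fromℕ (w * l) ℚ.≤ fromℕ w ℚ.* r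
  wl≤wr = begin
    fromℕ (w * l)          ≡⟨ fromℕ-* w l ⟩
    fromℕ w ℚ.* fromℕ l    ≤⟨ ℚ.*-monoˡ-≤-nonNeg (fromℕ w) {{fromℕ-nonNeg w}} (log₂-lower l 2ˡ≤y r y≤2ʳ) ⟩
    fromℕ w ℚ.* r          ∎

errors : DNF n → DNF n → ℕ
errors g f = mass 1 (λ x → disagree (⟦ g ⟧ x) (⟦ f ⟧ x))

Pr-errors≤ : ∀ (g f : DNF n) {p d-1} .{coprime : Coprime p (suc d-1)} →
  errors g f * suc d-1 ≤ p * 2 ^ n →
  Pr (λ x → ¬? (⟦ g ⟧ x Bool.≟ ⟦ f ⟧ x)) ℚ.≤ mkℚ (ℤ.+ p) d-1 coprime
Pr-errors≤ {n} g f {p} {d-1} few =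
  /-≤ (length (filter (λ x → ¬? (⟦ g ⟧ x Bool.≟ ⟦ f ⟧ x)) (points n))) (2 ^ n) {{m^n≢0 2 n}}
    (subst (λ c → c * suc d-1 ≤ p * 2 ^ n) (sym (disagreements ⟦ g ⟧ ⟦ f ⟧)) few)

crossing : {P : ℕ → Set} → Decidable P → ∀ a k → ¬ P a → P (k + a) →
  ∃[ l ] a ≤ l × ¬ P l × P (suc l)
crossing P? a zero    ¬Pa Pa = contradiction Pa ¬Pa
crossing P? a (suc k) ¬Pa P1+k+a with P? (k + a)
... | yes Pk+a = crossing P? a k ¬Pa Pk+a
... | no ¬Pk+a = k + a , m≤n+m a k , ¬Pk+a , P1+k+a

n<2^n : ∀ n → n < 2 ^ n
n<2^n zero    = s≤s z≤n
n<2^n (suc n) = +-mono-≤ (m^n>0 2 n) (≤-trans (n<2^n n) (m≤m+n (2 ^ n) 0))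

Approximable : ℕ → DNF n → (ε : ℚ) .{{_ : Positive ε}} → Set
Approximable w f ε = ∃[ fₗ ] ∃[ fᵤ ]
  ( width fₗ ≤ w × size fₗ ≤max[1,⟨ w ·log₂ size f /ε ε ⟩^ 7 * w ]
  × width fᵤ ≤ w × size fᵤ ≤max[1,⟨ w ·log₂ size f /ε ε ⟩^ 7 * w ]
  × Sandwiching ε ⟦ fₗ ⟧ ⟦ fᵤ ⟧ ⟦ f ⟧ )

module _ {p-1 d-1 : ℕ} .{coprime : Coprime (suc p-1) (suc d-1)} where

  p d : ℕ
  p = suc p-1
  d = suc d-1
  ε : ℚ
  ε = mkℚ +[1+ p-1 ] d-1 coprime

  never-wrong : ∀ (g f : DNF n) → (∀ x → ⟦ g ⟧ x ≡ ⟦ f ⟧ x) → errors g f * d ≤ p * 2 ^ n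
  never-wrong {n} g f g≡f = ≤-trans (≤-reflexive (cong (_* d) (trans
    (mass-cong 1 (λ x → trans (cong (disagree (⟦ g ⟧ x)) (sym (g≡f x))) (disagree-refl (⟦ g ⟧ x))))
    (mass-zero n 1)))) z≤n

  approximable-by : ∀ w (f fₗ fᵤ : DNF n) →
    width fₗ ≤ w → size fₗ ≤ 1 → width fᵤ ≤ w → size fᵤ ≤ 1 →
    (∀ x → ⟦ fₗ ⟧ x ≤ᵇ ⟦ f ⟧ x) → (∀ x → ⟦ f ⟧ x ≤ᵇ ⟦ fᵤ ⟧ x) →
    errors fₗ f * d ≤ p * 2 ^ n → errors fᵤ f * d ≤ p * 2 ^ n → Approximable w f ε
  approximable-by w f fₗ fᵤ narrowₗ shortₗ narrowᵤ shortᵤ below above fewₗ fewᵤ =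
    fₗ , fᵤ ,
    narrowₗ , small-size w (size f /ε ε) (7 * w) shortₗ ,
    narrowᵤ , small-size w (size f /ε ε) (7 * w) shortᵤ ,
    record
      { lower       = below
      ; upper       = above
      ; lower-error = Pr-errors≤ fₗ f fewₗ
      ; upper-error = Pr-errors≤ fᵤ f fewᵤ
      }

  approximable-itself : ∀ w (f : DNF n) → width f ≤ w → size f ≤ 1 → Approximable w f ε
  approximable-itself w f f≤w m≤1 = approximable-by w f f f f≤w m≤1 f≤w m≤1
    (λ x → Bool.≤-refl) (λ x → Bool.≤-refl) (never-wrong f f (λ _ → refl)) (never-wrong f f (λ _ → refl))

  approximable-constants : ∀ w (f : DNF n) → d ≤ p → Approximable w f ε
  approximable-constants {n} w f d≤p = approximable-by w f [] ([] ∷ []) z≤n z≤n z≤n ≤-refl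
    (λ x → Bool.≤-minimum _) (λ x → Bool.≤-maximum _) (any-error []) (any-error ([] ∷ []))
    where
    open ≤-Reasoning
    any-error : ∀ g → errors g f * d ≤ p * 2 ^ n
    any-error g = begin
      errors g f * d            ≤⟨ *-mono-≤ (mass-mono 1 {λ x → disagree (⟦ g ⟧ x) (⟦ f ⟧ x)} (λ x → 𝟙≤1 _)) d≤p ⟩
      mass {n} 1 (λ _ → 1) * p  ≡⟨ cong (_* p) (trans (mass-const n 1 1) (*-identityʳ (2 ^ n))) ⟩
      2 ^ n * p                 ≡⟨ *-comm (2 ^ n) p ⟩
      p * 2 ^ n                 ∎

  approximable-width-0 : ∀ t (f : DNF n) → width (t ∷ f) ≤ 0 → Approximable 0 (t ∷ f) ε
  approximable-width-0 [] f _ = approximable-by 0 ([] ∷ f) ([] ∷ []) ([] ∷ []) z≤n ≤-refl z≤n ≤-refl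
    (λ x → Bool.≤-refl) (λ x → Bool.≤-refl) always always
    where
    always = never-wrong ([] ∷ []) ([] ∷ f) (λ _ → refl)
  approximable-width-0 (l ∷ t) f narrow =
    contradiction (≤-trans (m≤m⊔n (suc (length t)) (width f)) narrow) n≮0

  -- For w = 1, m = 2 and ε close to 1 the size bound is below 2, so a single term has to do.
  approximable-width-1 : ∀ t (f : DNF n) → width (t ∷ f) ≤ 1 → d ≤ 2 * p → Approximable 1 (t ∷ f) ε
  approximable-width-1 {n} t f narrow d≤2p =
    approximable-by 1 (t ∷ f) (t ∷ []) ([] ∷ []) (⊔-lub t≤1 z≤n) ≤-refl z≤n ≤-refl
      (λ x → below (evalTerm t x) (⟦ f ⟧ x)) (λ x → Bool.≤-maximum _)
      (few-errors (t ∷ []) (λ x → lower≤ (evalTerm t x) (⟦ f ⟧ x)))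
      (few-errors ([] ∷ []) (λ x → upper≤ (evalTerm t x) (⟦ f ⟧ x)))
    where
    open ≤-Reasoning
    t≤1 : length t ≤ 1
    t≤1 = m⊔n≤o⇒m≤o (length t) (width f) narrow
    below : ∀ a c → (a ∨ false) ≤ᵇ (a ∨ c)
    below true  c = Bool.≤-refl
    below false c = Bool.≤-minimum c
    lower≤ : ∀ a c → disagree (a ∨ false) (a ∨ c) ≤ 𝟙 (not a)
    lower≤ true  c = z≤n
    lower≤ false c = 𝟙≤1 c
    upper≤ : ∀ a c → disagree true (a ∨ c) ≤ 𝟙 (not a)
    upper≤ true  c = z≤n
    upper≤ false c = 𝟙≤1 (not c)
    swap : ∀ x y → x * (2 * y) ≡ 2 * x * y
    swap = solve-∀
    few-errors : ∀ g → (∀ x → disagree (⟦ g ⟧ x) (⟦ t ∷ f ⟧ x) ≤ 𝟙 (not (evalTerm t x))) →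
      errors g (t ∷ f) * d ≤ p * 2 ^ n
    few-errors g bound = begin
      errors g (t ∷ f) * d                                   ≤⟨ *-mono-≤ (mass-mono 1 bound) d≤2p ⟩
      mass 1 (λ x → 𝟙 (not (evalTerm t x))) * (2 * p)        ≡⟨ swap (mass 1 (λ x → 𝟙 (not (evalTerm t x)))) p ⟩
      2 * mass 1 (λ x → 𝟙 (not (evalTerm t x))) * p          ≤⟨ *-monoˡ-≤ p (mass-short-term t t≤1) ⟩
      2 ^ n * p                                              ≡⟨ *-comm (2 ^ n) p ⟩
      p * 2 ^ n                                              ∎

  module _ {w : ℕ} .{{_ : NonZero w}} (f : DNF n) (unate : Unate f) (narrow : width f ≤ w) where

    approximable-at : ∀ l → 1 ≤ l → 2 ≤ w * l →
      ¬ (size f * d ≤ p * 2 ^ l) → size f * d ≤ p * 2 ^ suc l → Approximable w f ε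
    approximable-at l 1≤l 2≤wl large enough =
      signedDNF s (proj₁ lower) , signedDNF s (proj₁ upper) ,
      width-signedDNF s _ (Approximates.narrow (proj₂ (proj₂ lower))) ,
      bounded (proj₁ lower) (proj₁ (proj₂ lower)) ,
      width-signedDNF s _ (Approximates.narrow (proj₂ (proj₂ upper))) ,
      bounded (proj₁ upper) (proj₁ (proj₂ upper)) ,
      record
        { lower       = λ x → subst₂ _≤ᵇ_ (sym (⟦signedDNF⟧ s (proj₁ lower) x)) (sym (holds-supports f unate x))
            (Approximates.related (proj₂ (proj₂ lower)) (agree s x))
        ; upper       = λ x → subst₂ _≤ᵇ_ (sym (holds-supports f unate x)) (sym (⟦signedDNF⟧ s (proj₁ upper) x))
            (Approximates.related (proj₂ (proj₂ upper)) (agree s x))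
        ; lower-error = Pr-errors≤ (signedDNF s (proj₁ lower)) f
            (few-errors (proj₁ lower) (Approximates.error (proj₂ (proj₂ lower))))
        ; upper-error = Pr-errors≤ (signedDNF s (proj₁ upper)) f
            (few-errors (proj₁ upper) (Approximates.error (proj₂ (proj₂ upper))))
        }
      where
      open ≤-Reasoning
      s = signs f
      F = supports f
      k = suc l
      b = l + suc (l + 0)
      m = size f
      half : suc b ^ k ≤ 2 * b ^ k
      half = *-cancelʳ-≤ _ _ k (begin
        suc b ^ k * k              ≡⟨ cong (suc b ^ k *_) (trans (m+n∸m≡n k (k + 0)) (+-identityʳ k)) ⟨
        suc b ^ k * (suc b ∸ k)    ≤⟨ bernoulli b k ⟩
        b ^ k * (2 * k)            ≡⟨ swap (b ^ k) k ⟩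
        2 * b ^ k * k              ∎)
        where
        swap : ∀ x y → x * (2 * y) ≡ 2 * x * y
        swap = solve-∀
      lower = sparsify w b k half Bool.≤-refl Bool.≤-trans (lower-step w b k half) m F
        (≤-reflexive (length-map support f)) (supports-narrow f narrow)
      upper = sparsify w b k half Bool.≤-refl (flip Bool.≤-trans) (upper-step w b k half) m F
        (≤-reflexive (length-map support f)) (supports-narrow f narrow)
      bounded : ∀ G → length G ≤ 2 * K w b ^ w →
        size (signedDNF s G) ≤max[1,⟨ w ·log₂ m /ε ε ⟩^ 7 * w ]
      bounded G short = sparse-size w l (m /ε ε) 1≤l 2≤wl
        (≤-/ε (2 ^ l) m {coprime = coprime} (≤-trans (≤-reflexive (*-comm (2 ^ l) p)) (<⇒≤ (≰⇒> large))))
        (≤-trans (≤-reflexive (length-map (signedTerm s) G)) short)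
      few-errors : ∀ G → mass 1 (λ x → disagree (holds G x) (holds F x)) * 2 ^ k ≤ m * 2 ^ n →
        errors (signedDNF s G) f * d ≤ p * 2 ^ n
      few-errors G error = *-cancelʳ-≤ _ _ (2 ^ k) {{m^n≢0 2 k}} (begin
        errors (signedDNF s G) f * d * 2 ^ k
          ≡⟨ cong (λ c → c * d * 2 ^ k) transfer ⟩
        wrong * d * 2 ^ k    ≡⟨ rotate wrong d (2 ^ k) ⟩
        wrong * 2 ^ k * d    ≤⟨ *-monoˡ-≤ d error ⟩
        m * 2 ^ n * d         ≡⟨ rotate m (2 ^ n) d ⟩
        m * d * 2 ^ n         ≤⟨ *-monoˡ-≤ (2 ^ n) enough ⟩
        p * 2 ^ k * 2 ^ n     ≡⟨ rotate p (2 ^ k) (2 ^ n) ⟩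
        p * 2 ^ n * 2 ^ k     ∎)
        where
        wrong = mass 1 (λ x → disagree (holds G x) (holds F x))
        rotate : ∀ x y z → x * y * z ≡ x * z * y
        rotate = solve-∀
        transfer : errors (signedDNF s G) f ≡ wrong
        transfer = trans
          (mass-cong 1 (λ x → cong₂ disagree (⟦signedDNF⟧ s G x) (holds-supports f unate x)))
          (mass-agree s (λ y → disagree (holds G y) (holds F y)))

    approximable-from : ∀ a → 1 ≤ a → 2 ≤ w * a → ¬ (size f * d ≤ p * 2 ^ a) → Approximable w f ε
    approximable-from a 1≤a 2≤wa large
      with crossing (λ l → size f * d ≤? p * 2 ^ l) a (size f * d) large reached
      where
      open ≤-Reasoning
      reached : size f * d ≤ p * 2 ^ (size f * d + a)
      reached = begin
        size f * d                     ≤⟨ <⇒≤ (n<2^n (size f * d)) ⟩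
        2 ^ (size f * d)               ≤⟨ ^-monoʳ-≤ 2 (m≤m+n (size f * d) a) ⟩
        2 ^ (size f * d + a)           ≤⟨ m≤n*m _ p ⟩
        p * 2 ^ (size f * d + a)       ∎
    ... | l , a≤l , large′ , enough =
      approximable-at l (≤-trans 1≤a a≤l) (≤-trans 2≤wa (*-monoʳ-≤ w a≤l)) large′ enough

  approximable : ∀ w (f : DNF n) → Unate f → width f ≤ w → Approximable w f ε
  approximable w []      unate narrow = approximable-itself w [] narrow z≤n
  approximable w (t ∷ []) unate narrow = approximable-itself w (t ∷ []) narrow ≤-refl
  approximable w f@(t ∷ f′@(_ ∷ _)) unate narrow with d ≤? p
  ... | yes d≤p = approximable-constants w f d≤p
  approximable zero f@(t ∷ f′@(_ ∷ _)) unate narrow | no p<d = approximable-width-0 t f′ narrow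
  approximable (suc zero) f@(t ∷ f′@(_ ∷ _)) unate narrow | no p<d with d ≤? 2 * p
  ... | yes d≤2p = approximable-width-1 t f′ narrow d≤2p
  ... | no 2p<d  = approximable-from f unate narrow 2 (s≤s z≤n) ≤-refl (<⇒≱ (begin-strict
    p * 4              ≡⟨ rearrange p ⟩
    2 * (2 * p)        <⟨ *-monoʳ-< 2 (≰⇒> 2p<d) ⟩
    2 * d              ≤⟨ *-monoˡ-≤ d {2} {size f} (s≤s (s≤s z≤n)) ⟩
    size f * d         ∎))
    where
    open ≤-Reasoning
    rearrange : ∀ p → p * 4 ≡ 2 * (2 * p)
    rearrange = solve-∀
  approximable w@(suc (suc w-2)) f@(t ∷ f′@(_ ∷ _)) unate narrow | no p<d =
    approximable-from f unate narrow 1 ≤-refl (s≤s (s≤s z≤n)) (<⇒≱ (begin-strict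
      p * 2              ≡⟨ *-comm p 2 ⟩
      2 * p              <⟨ *-monoʳ-< 2 (≰⇒> p<d) ⟩
      2 * d              ≤⟨ *-monoˡ-≤ d {2} {size f} (s≤s (s≤s z≤n)) ⟩
      size f * d         ∎))
    where open ≤-Reasoning

theorem2p1 : ∃[ C ] (∀ (n w : ℕ) (f : DNF n) → Unate f → width f ≤ w →
    ∀ (ε : ℚ) .{{_ : Positive ε}} →
    ∃[ fₗ ] ∃[ fᵤ ]
    ( width fₗ ≤ w × size fₗ ≤max[1,⟨ w ·log₂ size f /ε ε ⟩^ C * w ]
    × width fᵤ ≤ w × size fᵤ ≤max[1,⟨ w ·log₂ size f /ε ε ⟩^ C * w ]
    × Sandwiching ε ⟦ fₗ ⟧ ⟦ fᵤ ⟧ ⟦ f ⟧ ))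
theorem2p1 = 7 , λ where
  n w f unate narrow (mkℚ +[1+ _ ] _ _) → approximable w f unate narrow
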